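{- Let $\theta \in (0,1) \cap \mathbb{Q}$, and let $w = w(n)$ be a positive real-valued function of the positive integer $n$ with $w(n) = O(n^{1/3})$. There is a constant $C > 0$ such that, for all sufficiently large $n$, every $w(n)$-bounded $\theta$-intersecting family $\mathcal{F}$ over $[n]$ satisfies $|\mathcal{F}| \leq C n$.
   Context: Write $[n] = \{1,\dots,n\}$. A family over $[n]$ is a set of (distinct) subsets of $[n]$. For $\theta \in (0,1)\cap\mathbb{Q}$, a (fractional) $\theta$-intersecting family over $[n]$ is a collection $\mathcal{F}$ of nonempty subsets of $[n]$ such that for all $A, B \in \mathcal{F}$ with $A \neq B$ we have $|A \cap B| \in \{\theta |A|, \theta |B|\}$. For a positive real $w$, a family of sets is $w$-bounded if every set in the family has size at most $w$. -}

module Defs where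

open import Data.Fin.Subset using (Subset; Nonempty; _∩_; ∣_∣)
open import Data.Integer using (+_)
open import Data.List using (List; length)
open import Data.List.Membership.Propositional using (_∈_)
open import Data.List.Relation.Unary.Unique.Propositional using (Unique)
open import Data.Nat as ℕ using (ℕ)
open import Data.Product using (∃; ∃-syntax; Σ-syntax; _×_; _,_)
open import Data.Rational hiding (∣_∣)
open import Data.Rational.Properties
open import Data.Sum using (_⊎_; inj₁; inj₂)
open import Relation.Binary.PropositionalEquality
open import Relation.Nullary using (¬_; yes; no)

fromℕ : ℕ → ℚ
fromℕ n = + n / 1

-- Two-sided Dedekind cuts: L q means q < x, and U q means x < q.
record ℝ : Set₁ where
  field
    L U         : ℚ → Set
    L-inhabited : ∃ L
    U-inhabited : ∃ U
    L-closed    : ∀ {q r} → q < r → L r → L q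
    U-closed    : ∀ {q r} → q < r → U q → U r
    L-rounded   : ∀ {q} → L q → ∃[ r ] q < r × L r
    U-rounded   : ∀ {r} → U r → ∃[ q ] q < r × U q
    disjoint    : ∀ {q} → L q → ¬ U q
    located     : ∀ {q r} → q < r → L q ⊎ U r

open ℝ

infix 4 _≤ᵣ_

-- By locatedness and roundedness, equivalent to U y ⊆ U x.
_≤ᵣ_ : ℝ → ℝ → Set
x ≤ᵣ y = ∀ q → L x q → L y q

Positiveᵣ : ℝ → Set
Positiveᵣ x = L x 0ℚ

private
  p-1<p : ∀ p → p - 1ℚ < p
  p-1<p p = subst (p - 1ℚ <_) (+-identityʳ p)
    (+-monoʳ-< p {x = - 1ℚ} {y = 0ℚ} (negative⁻¹ (- 1ℚ)))

  p<p+1 : ∀ p → p < p + 1ℚ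
  p<p+1 p = subst (_< p + 1ℚ) (+-identityʳ p)
    (+-monoʳ-< p {x = 0ℚ} {y = 1ℚ} (positive⁻¹ 1ℚ))

  split : ∀ p {q r} → q < r → q < p ⊎ p < r
  split p {q} q<r with q <? p
  ... | yes q<p = inj₁ q<p
  ... | no  q≮p = inj₂ (≤-<-trans (≮⇒≥ q≮p) q<r)

fromℚ : ℚ → ℝ
fromℚ p = record
  { L           = _< p
  ; U           = p <_
  ; L-inhabited = p - 1ℚ , p-1<p p
  ; U-inhabited = p + 1ℚ , p<p+1 p
  ; L-closed    = <-trans
  ; U-closed    = λ q<r p<q → <-trans p<q q<r
  ; L-rounded   = <-dense
  ; U-rounded   = λ p<r → let q , p<q , q<r = <-dense p<r in q , q<r , p<q
  ; disjoint    = <-asym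
  ; located     = split p
  }

private
  module _ (K : ℚ) .{{K>0 : Positive K}} where
    instance
      K≢0 : NonZero K
      K≢0 = pos⇒nonZero K

      1/K>0 : Positive (1/ K)
      1/K>0 = 1/pos⇒pos K

    ÷-mono-< : ∀ {q r} → q < r → q ÷ K < r ÷ K
    ÷-mono-< = *-monoˡ-<-pos (1/ K)

    *-÷-cancel : ∀ q → (q * K) ÷ K ≡ q
    *-÷-cancel q = trans (*-assoc q K (1/ K))
      (trans (cong (q *_) (*-inverseʳ K)) (*-identityʳ q))

    ÷-*-cancel : ∀ q → (q ÷ K) * K ≡ q
    ÷-*-cancel q = trans (*-assoc q (1/ K) K)
      (trans (cong (q *_) (*-inverseˡ K)) (*-identityʳ q))

    <÷⇒ : ∀ {q r} → q ÷ K < r → q < r * K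
    <÷⇒ {q} q/K<r = subst (_< _) (÷-*-cancel q) (*-monoˡ-<-pos K q/K<r)

    ÷<⇒ : ∀ {q r} → q < r ÷ K → q * K < r
    ÷<⇒ {r = r} q<r/K = subst (_ <_) (÷-*-cancel r) (*-monoˡ-<-pos K q<r/K)

    scale : ℝ → ℝ
    scale x = record
      { L           = λ q → L x (q ÷ K)
      ; U           = λ q → U x (q ÷ K)
      ; L-inhabited = let q , l = L-inhabited x in
                      q * K , subst (L x) (sym (*-÷-cancel q)) l
      ; U-inhabited = let q , u = U-inhabited x in
                      q * K , subst (U x) (sym (*-÷-cancel q)) u
      ; L-closed    = λ q<r → L-closed x (÷-mono-< q<r)
      ; U-closed    = λ q<r → U-closed x (÷-mono-< q<r)
      ; L-rounded   = λ l → let r , q<r , l′ = L-rounded x l in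
                      r * K , <÷⇒ q<r , subst (L x) (sym (*-÷-cancel r)) l′
      ; U-rounded   = λ u → let q , q<r , u′ = U-rounded x u in
                      q * K , ÷<⇒ q<r , subst (U x) (sym (*-÷-cancel q)) u′
      ; disjoint    = disjoint x
      ; located     = λ q<r → located x (÷-mono-< q<r)
      }

infixr 7 _•_

_•_ : (K : ℚ) .{{_ : Positive K}} → ℝ → ℝ
K • x = scale K x

_³ : ℚ → ℚ
q ³ = q * q * q

infixl 8 _³

private
  ³-neg : ∀ {q} → q < 0ℚ → q ³ < 0ℚ
  ³-neg {q} q<0 = negative⁻¹ (q ³) {{pos*neg⇒neg (q * q) {{neg*neg⇒pos q q}} q}}
    where instance
      _ : Negative q
      _ = negative q<0

  ³-mono-< : ∀ {q r} → 0ℚ ≤ q → q < r → q ³ < r ³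
  ³-mono-< {q} {r} 0≤q q<r = begin-strict
    q * q * q ≤⟨ *-monoʳ-≤-nonNeg q (*-monoʳ-≤-nonNeg q q≤r) ⟩
    r * q * q ≤⟨ *-monoʳ-≤-nonNeg q (*-monoˡ-≤-nonNeg r q≤r) ⟩
    r * r * q <⟨ *-monoʳ-<-pos (r * r) q<r ⟩
    r * r * r ∎
    where
    open ≤-Reasoning
    q≤r = <⇒≤ q<r
    instance
      _ : NonNegative q
      _ = nonNegative 0≤q
      r>0 : Positive r
      r>0 = positive (≤-<-trans 0≤q q<r)
      _ : NonNegative r
      _ = pos⇒nonNeg r
      _ : Positive (r * r)
      _ = pos*pos⇒pos r r

  ³-expansive : ∀ {q} → 1ℚ ≤ q → q ≤ q ³
  ³-expansive {q} 1≤q = begin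
    q         ≤⟨ q≤q² ⟩
    q * q     ≤⟨ *-monoʳ-≤-nonNeg q q≤q² ⟩
    q * q * q ∎
    where
    open ≤-Reasoning
    instance
      _ : NonNegative q
      _ = nonNegative (≤-trans (nonNegative⁻¹ 1ℚ) 1≤q)
    q≤q² : q ≤ q * q
    q≤q² = subst (_≤ q * q) (*-identityˡ q) (*-monoʳ-≤-nonNeg q 1≤q)

-- The sets {q | q³ < n} and {q | n < q³} are already open; quantifying over
-- a point strictly beyond q makes roundedness immediate.
∛ : ℕ → ℝ
∛ n = record
  { L           = λ q → ∃[ r ] q < r × r ³ < fromℕ n
  ; U           = λ q → ∃[ r ] r < q × fromℕ n < r ³
  ; L-inhabited = - 1ℚ - 1ℚ , - 1ℚ , p-1<p (- 1ℚ) ,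
                  <-≤-trans (³-neg (negative⁻¹ (- 1ℚ))) 0≤n
  ; U-inhabited = n′ + 1ℚ , n′ , p<p+1 n′ ,
                  <-≤-trans (p<p+1 (fromℕ n)) (³-expansive 1≤n′)
  ; L-closed    = λ q<q′ (r , q′<r , h) → r , <-trans q<q′ q′<r , h
  ; U-closed    = λ q<q′ (r , r<q , h) → r , <-trans r<q q<q′ , h
  ; L-rounded   = λ (r , q<r , h) → let q′ , q<q′ , q′<r = <-dense q<r in
                  q′ , q<q′ , r , q′<r , h
  ; U-rounded   = λ (r , r<q , h) → let q′ , r<q′ , q′<q = <-dense r<q in
                  q′ , q′<q , r , r<q′ , h
  ; disjoint    = λ (s , q<s , s³<n) (r , r<q , n<r³) →
                  <-asym (<-trans s³<n n<r³)
                         (³-mono-< (n<r³⇒0≤r n<r³) (<-trans r<q q<s))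
  ; located     = loc
  }
  where
  n′ = fromℕ n + 1ℚ

  0≤n : 0ℚ ≤ fromℕ n
  0≤n = nonNegative⁻¹ (fromℕ n) {{normalize-nonNeg n 1}}

  1≤n′ : 1ℚ ≤ n′
  1≤n′ = subst (_≤ n′) (+-identityˡ 1ℚ) (+-monoˡ-≤ 1ℚ 0≤n)

  n<r³⇒0≤r : ∀ {r} → fromℕ n < r ³ → 0ℚ ≤ r
  n<r³⇒0≤r n<r³ = ≮⇒≥ λ r<0 →
    <-asym (³-neg r<0) (≤-<-trans 0≤n n<r³)

  loc : ∀ {q s} → q < s →
        (∃[ r ] q < r × r ³ < fromℕ n) ⊎ (∃[ r ] r < s × fromℕ n < r ³)
  loc q<s with <-dense q<s
  ... | a , q<a , a<s with a ³ <? fromℕ n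
  ...   | yes a³<n = inj₁ (a , q<a , a³<n)
  ...   | no  a³≮n with <-dense a<s
  ...     | b , a<b , b<s = inj₂ (b , b<s ,
            ≤-<-trans (≮⇒≥ a³≮n) (³-mono-< 0≤a a<b))
    where
    0≤a = ≮⇒≥ λ a<0 → a³≮n (<-≤-trans (³-neg a<0) 0≤n)

Seq : Set₁
Seq = (n : ℕ) → .{{ℕ.NonZero n}} → ℝ

-- No absolute value is taken: this is the usual notion for nonnegative f, g.
-- Since every real is below some rational, a rational constant loses nothing.
_=O[_] : Seq → Seq → Set
f =O[ g ] = ∃[ K ] Σ[ K>0 ∈ Positive K ] ∃[ N ]
  ∀ n → .{{_ : ℕ.NonZero n}} → N ℕ.≤ n → f n ≤ᵣ _•_ K {{K>0}} (g n)

record Family (n : ℕ) : Set where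
  field
    members  : List (Subset n)
    distinct : Unique members

open Family public

size : ∀ {n} → Family n → ℕ
size F = length (members F)

record Intersecting (θ : ℚ) {n : ℕ} (F : Family n) : Set where
  field
    nonempty     : ∀ {A} → A ∈ members F → Nonempty A
    intersecting : ∀ {A B} → A ∈ members F → B ∈ members F → A ≢ B →
                   fromℕ ∣ A ∩ B ∣ ≡ θ * fromℕ ∣ A ∣ ⊎
                   fromℕ ∣ A ∩ B ∣ ≡ θ * fromℕ ∣ B ∣

Bounded : ℝ → ∀ {n} → Family n → Set
Bounded w F = ∀ {A} → A ∈ members F → fromℚ (fromℕ ∣ A ∣) ≤ᵣ w

{-# OPTIONS --safe #-}

-- Write θ = a / b and let V be the largest size of a member, so V³ = O(n). A layer
-- (the members of one size k) meets pairwise in exactly θk points. Layers with at most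
-- 3V² members contribute O(V³) = O(n) in total. In a larger layer a variance argument shows
-- that every point lies in few or in almost all members; the points of the second kind
-- form a kernel of size θk, and the layer is a sunflower. Its kernel is contained in every
-- member of size at least k, because the disjoint petals cannot all meet such a member.
-- Hence, if petals of members of sizes k < l share a point, their members meet in
-- more than θk, so in θl, points, and θl ≤ k. Charging each member to the points of its
-- petal with weight 1 / k, each point receives O(1), so the larger layers have O(n)
-- members in total.
module Submission where

open import Defs

module Combinatorics where

  open import Data.Bool using (Bool; true; false; not; _∧_)
  open import Data.Bool.Properties using () renaming (_≟_ to _≟ᵇ_)
  open import Data.Fin using (Fin; zero; suc)
  open import Data.Fin.Subset as Subset using (Subset; _∩_; ∁; ∣_∣; inside; outside)
  open import Data.Fin.Subset.Properties using (∩-comm; ∩-idem; _∈?_; p∩q⊆p; p∩q⊆q; x∈p∩q⁺; p⊂q⇒∣p∣<∣q∣; p⊆q⇒∣p∣≤∣q∣; ∣p∩q∣≤∣p∣; ∣p∩q∣≤∣q∣; x∈∁p⇒x∉p)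
  open import Data.List using (List; []; _∷_; length; map; allFin; filter; upTo)
  open import Data.List.Membership.Propositional using (_∈_)
  open import Data.List.Membership.Propositional.Properties using (∈-allFin; ∈-upTo⁺; ∈-filter⁻)
  open import Data.List.Properties using (map-tabulate; length-tabulate; length-upTo)
  open import Data.List.Relation.Unary.All as All using (All; []; _∷_)
  open import Data.List.Relation.Unary.AllPairs using (AllPairs; []; _∷_)
  import Data.List.Relation.Unary.AllPairs.Properties as AllPairs
  open import Data.List.Relation.Unary.Any using (here; there)
  open import Data.List.Relation.Unary.Unique.Propositional using (Unique)
  open import Data.Nat using (ℕ; zero; suc; _+_; _*_; _≤_; _<_; z≤n; s≤s; ∣_-_∣; NonZero; >-nonZero; _<?_; _≤?_; _≟_; _!; _/_)
  open import Data.Nat.Divisibility using (n∣m⇒m%n≡0; m≤n⇒m!∣n!; m∣m*n; ∣-trans)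
  open import Data.Nat.DivMod using (m≡m%n+[m/n]*n)
  open import Data.Nat.ListAction using (sum)
  open import Data.Nat.Properties hiding (_≟_; _<?_; _≤?_)
  open import Data.Nat.Tactic.RingSolver using (solve-∀)
  open import Data.Product using (∃; _×_; _,_; proj₁; proj₂)
  open import Data.Sum using (_⊎_; inj₁; inj₂)
  open import Data.Vec as Vec using ([]; _∷_; lookup)
  open import Data.Vec.Properties using (≡-dec; lookup-zipWith; lookup-map; lookup∘tabulate; []=⇒lookup; lookup⇒[]=)
  open import Function using (_∘_; id)
  open import Relation.Binary.PropositionalEquality
  open import Relation.Nullary using (Dec; yes; no; does; contradiction)
  open import Relation.Nullary.Decidable using (dec-true; dec-false)
  open import Relation.Unary using (Decidable)

  private
    variable
      X Y : Set
      n : ℕ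

  -- Finite sums and indicators

  ∑ : List X → (X → ℕ) → ℕ
  ∑ xs f = sum (map f xs)

  ∑-mono : ∀ (xs : List X) {f g : X → ℕ} → (∀ {x} → x ∈ xs → f x ≤ g x) → ∑ xs f ≤ ∑ xs g
  ∑-mono []       f≤g = z≤n
  ∑-mono (x ∷ xs) f≤g = +-mono-≤ (f≤g (here refl)) (∑-mono xs (f≤g ∘ there))

  ∑-cong∈ : ∀ (xs : List X) {f g : X → ℕ} → (∀ {x} → x ∈ xs → f x ≡ g x) → ∑ xs f ≡ ∑ xs g
  ∑-cong∈ []       f≡g = refl
  ∑-cong∈ (x ∷ xs) f≡g = cong₂ _+_ (f≡g (here refl)) (∑-cong∈ xs (f≡g ∘ there))

  ∑-cong : ∀ (xs : List X) {f g : X → ℕ} → (∀ x → f x ≡ g x) → ∑ xs f ≡ ∑ xs g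
  ∑-cong xs f≡g = ∑-cong∈ xs λ {x} _ → f≡g x

  ∑-const : ∀ (xs : List X) c → ∑ xs (λ _ → c) ≡ length xs * c
  ∑-const []       c = refl
  ∑-const (x ∷ xs) c = cong (c +_) (∑-const xs c)

  ∑-+ : ∀ (xs : List X) f g → ∑ xs (λ x → f x + g x) ≡ ∑ xs f + ∑ xs g
  ∑-+ []       f g = refl
  ∑-+ (x ∷ xs) f g = trans (cong (f x + g x +_) (∑-+ xs f g)) (lemma (f x) (g x) (∑ xs f) (∑ xs g))
    where
    lemma : ∀ a b c d → a + b + (c + d) ≡ a + c + (b + d)
    lemma = solve-∀

  ∑-*ˡ : ∀ (xs : List X) c f → ∑ xs (λ x → c * f x) ≡ c * ∑ xs f
  ∑-*ˡ []       c f = sym (*-zeroʳ c)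
  ∑-*ˡ (x ∷ xs) c f = trans (cong (c * f x +_) (∑-*ˡ xs c f)) (sym (*-distribˡ-+ c (f x) _))

  ∑-*ʳ : ∀ (xs : List X) f c → ∑ xs (λ x → f x * c) ≡ ∑ xs f * c
  ∑-*ʳ xs f c = trans (∑-cong xs λ x → *-comm (f x) c) (trans (∑-*ˡ xs c f) (*-comm c _))

  ∑-swap : ∀ (xs : List X) (ys : List Y) (f : X → Y → ℕ) →
    ∑ xs (λ x → ∑ ys (f x)) ≡ ∑ ys (λ y → ∑ xs λ x → f x y)
  ∑-swap []       ys f = sym (trans (∑-const ys 0) (*-zeroʳ (length ys)))
  ∑-swap (x ∷ xs) ys f = trans (cong (∑ ys (f x) +_) (∑-swap xs ys f)) (sym (∑-+ ys (f x) _))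

  ∑-∈ : ∀ {xs : List X} f {x} → x ∈ xs → f x ≤ ∑ xs f
  ∑-∈ f (here refl)          = m≤m+n _ _
  ∑-∈ {xs = y ∷ _} f (there x∈xs) = ≤-trans (∑-∈ f x∈xs) (m≤n+m _ (f y))

  ∑-* : ∀ (xs : List X) (ys : List Y) f g →
    ∑ xs f * ∑ ys g ≡ ∑ xs (λ x → ∑ ys λ y → f x * g y)
  ∑-* xs ys f g = sym (trans (∑-cong xs λ x → ∑-*ˡ ys (f x) g) (∑-*ʳ xs f (∑ ys g)))

  𝟙 : Bool → ℕ
  𝟙 true  = 1
  𝟙 false = 0

  𝟙-not : ∀ b → 𝟙 b + 𝟙 (not b) ≡ 1
  𝟙-not true  = refl
  𝟙-not false = refl

  ∑-filter : ∀ {P : X → Set} (P? : Decidable P) (xs : List X) f →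
    ∑ (filter P? xs) f ≡ ∑ xs (λ x → 𝟙 (does (P? x)) * f x)
  ∑-filter P? []       f = refl
  ∑-filter P? (x ∷ xs) f with does (P? x)
  ... | true  = cong₂ _+_ (sym (+-identityʳ (f x))) (∑-filter P? xs f)
  ... | false = ∑-filter P? xs f

  ∑-allFin-suc : ∀ (f : Fin (suc n) → ℕ) → ∑ (allFin (suc n)) f ≡ f zero + ∑ (allFin n) (f ∘ suc)
  ∑-allFin-suc f = cong (λ xs → f zero + sum xs)
    (trans (map-tabulate suc f) (sym (map-tabulate id (f ∘ suc))))

  -- Characteristic functions, degrees and double counting

  χ : Subset n → Fin n → ℕ
  χ A x = 𝟙 (lookup A x)

  ∣A∣≡∑χ : ∀ (A : Subset n) → ∣ A ∣ ≡ ∑ (allFin n) (χ A)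
  ∣A∣≡∑χ []      = refl
  ∣A∣≡∑χ (inside  ∷ A) = trans (cong suc (∣A∣≡∑χ A)) (sym (∑-allFin-suc (χ (inside ∷ A))))
  ∣A∣≡∑χ (outside ∷ A) = trans (∣A∣≡∑χ A) (sym (∑-allFin-suc (χ (outside ∷ A))))

  χ-∩ : ∀ (A B : Subset n) x → χ (A ∩ B) x ≡ χ A x * χ B x
  χ-∩ A B x rewrite lookup-zipWith _∧_ x A B with lookup A x
  ... | true  = sym (+-identityʳ _)
  ... | false = refl

  χ-∁ : ∀ (A : Subset n) x → χ A x + χ (∁ A) x ≡ 1
  χ-∁ A x rewrite lookup-map x not A = 𝟙-not (lookup A x)

  χ-idem : ∀ (A : Subset n) x → χ A x * χ A x ≡ χ A x
  χ-idem A x with lookup A x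
  ... | true  = refl
  ... | false = refl

  χ-∁-orth : ∀ (A : Subset n) x → χ A x * χ (∁ A) x ≡ 0
  χ-∁-orth A x rewrite lookup-map x not A with lookup A x
  ... | true  = refl
  ... | false = refl

  ∣∩∣≡∑ : ∀ (A B : Subset n) → ∣ A ∩ B ∣ ≡ ∑ (allFin n) (λ x → χ A x * χ B x)
  ∣∩∣≡∑ A B = trans (∣A∣≡∑χ (A ∩ B)) (∑-cong (allFin _) (χ-∩ A B))

  -- The codegree is a sum in its own right, so that no truncated subtraction from the number of
  -- members occurs.
  deg codeg : List (Subset n) → Fin n → ℕ
  deg   As x = ∑ As λ A → χ A x
  codeg As x = ∑ As λ A → χ (∁ A) x

  deg+codeg : ∀ (As : List (Subset n)) x → deg As x + codeg As x ≡ length As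
  deg+codeg As x = begin
    deg As x + codeg As x            ≡⟨ ∑-+ As _ _ ⟨
    ∑ As (λ A → χ A x + χ (∁ A) x)   ≡⟨ ∑-cong As (λ A → χ-∁ A x) ⟩
    ∑ As (λ _ → 1)                   ≡⟨ ∑-const As 1 ⟩
    length As * 1                    ≡⟨ *-identityʳ _ ⟩
    length As                        ∎
    where open ≡-Reasoning

  -- Double counting of the pairs of a member A and a point of A ∩ B.
  ∑∣∩∣≡∑deg : ∀ {n} (As : List (Subset n)) B →
    ∑ As (λ A → ∣ A ∩ B ∣) ≡ ∑ (allFin n) (λ x → deg As x * χ B x)
  ∑∣∩∣≡∑deg {n} As B = begin
    ∑ As (λ A → ∣ A ∩ B ∣)                              ≡⟨ ∑-cong As (λ A → ∣∩∣≡∑ A B) ⟩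
    ∑ As (λ A → ∑ (allFin n) λ x → χ A x * χ B x)       ≡⟨ ∑-swap As (allFin n) _ ⟩
    ∑ (allFin n) (λ x → ∑ As λ A → χ A x * χ B x)       ≡⟨ ∑-cong (allFin n) (λ x → ∑-*ʳ As _ (χ B x)) ⟩
    ∑ (allFin n) (λ x → deg As x * χ B x)               ∎
    where open ≡-Reasoning

  -- The expansion of (a - b)² with the cross term moved to the other side, as the arithmetic stays
  -- in ℕ.
  a²+b² : ∀ a b → a * a + b * b ≡ 2 * (a * b) + ∣ a - b ∣ * ∣ a - b ∣
  a²+b² zero    b       = refl
  a²+b² (suc a) zero    = lemma (suc a)
    where
    lemma : ∀ a → a * a + 0 * 0 ≡ 2 * (a * 0) + a * a
    lemma = solve-∀
  a²+b² (suc a) (suc b) = begin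
    suc a * suc a + suc b * suc b           ≡⟨ lemma₁ a b ⟩
    a * a + b * b + 2 * (1 + a + b)         ≡⟨ cong (_+ 2 * (1 + a + b)) (a²+b² a b) ⟩
    2 * (a * b) + d + 2 * (1 + a + b)       ≡⟨ lemma₂ a b d ⟩
    2 * (suc a * suc b) + d                 ∎
    where
    open ≡-Reasoning
    d = ∣ a - b ∣ * ∣ a - b ∣
    lemma₁ : ∀ a b → suc a * suc a + suc b * suc b ≡ a * a + b * b + 2 * (1 + a + b)
    lemma₁ = solve-∀
    lemma₂ : ∀ a b d → 2 * (a * b) + d + 2 * (1 + a + b) ≡ 2 * (suc a * suc b) + d
    lemma₂ = solve-∀

  -- Families with constant pairwise intersections

  -- Since m + n ≤ 2 n, a factor n cancels. Applied with m the smaller of degree and codegree, it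
  -- turns `deg*codeg≤` into an absolute bound on m.
  m*n≤o*[m+n]⇒m≤2*o : ∀ m n o → m ≤ n → m * n ≤ o * (m + n) → m ≤ 2 * o
  m*n≤o*[m+n]⇒m≤2*o m zero        o m≤0 _ = ≤-trans m≤0 z≤n
  m*n≤o*[m+n]⇒m≤2*o m n@(suc _) o m≤n mn≤ = *-cancelʳ-≤ m (2 * o) n (begin
    m * n          ≤⟨ mn≤ ⟩
    o * (m + n)    ≤⟨ *-monoʳ-≤ o (+-monoˡ-≤ n m≤n) ⟩
    o * (n + n)    ≡⟨ lemma o n ⟩
    2 * o * n      ∎)
    where
    open ≤-Reasoning
    lemma : ∀ o n → o * (n + n) ≡ 2 * o * n
    lemma = solve-∀

  module _ {l μ : ℕ} where

    -- The Gram matrix of the members is l J + μ I, with J the all-ones matrix, and both sides are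
    -- its bilinear form at f and g. The induction peels off the first row and column.
    gram : ∀ {As : List (Subset n)} →
      AllPairs (λ A B → ∣ A ∩ B ∣ ≡ l) As → All (λ A → ∣ A ∣ ≡ l + μ) As →
      ∀ f g → ∑ As (λ A → ∑ As λ B → f A * g B * ∣ A ∩ B ∣) ≡
              l * (∑ As f * ∑ As g) + μ * ∑ As (λ A → f A * g A)
    gram [] [] f g = sym (cong₂ _+_ (*-zeroʳ l) (*-zeroʳ μ))
    gram {As = A ∷ As} (A∩ ∷ ps) (∣A∣ ∷ ss) f g = begin
      f A * g A * ∣ A ∩ A ∣ + ∑ As (λ B → f A * g B * ∣ A ∩ B ∣) +
        ∑ As (λ A′ → f A′ * g A * ∣ A′ ∩ A ∣ + ∑ As (λ B → f A′ * g B * ∣ A′ ∩ B ∣))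
          ≡⟨ cong₂ _+_ (cong₂ _+_ (cong (f A * g A *_) (trans (cong ∣_∣ (∩-idem A)) ∣A∣)) row)
                       (trans (∑-+ As _ _) (cong₂ _+_ column (gram ps ss f g))) ⟩
      f A * g A * (l + μ) + f A * G * l +
        (F * g A * l + (l * (F * G) + μ * D))
          ≡⟨ lemma (f A) (g A) l μ F G D ⟩
      l * ((f A + F) * (g A + G)) + μ * (f A * g A + D) ∎
      where
      open ≡-Reasoning
      F G D : ℕ
      F = ∑ As f
      G = ∑ As g
      D = ∑ As λ B → f B * g B

      row : ∑ As (λ B → f A * g B * ∣ A ∩ B ∣) ≡ f A * G * l
      row = begin
        ∑ As (λ B → f A * g B * ∣ A ∩ B ∣) ≡⟨ ∑-cong∈ As (λ {B} B∈ → cong (f A * g B *_) (All.lookup A∩ B∈)) ⟩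
        ∑ As (λ B → f A * g B * l)         ≡⟨ ∑-*ʳ As _ l ⟩
        ∑ As (λ B → f A * g B) * l         ≡⟨ cong (_* l) (∑-*ˡ As (f A) g) ⟩
        f A * G * l                        ∎

      column : ∑ As (λ B → f B * g A * ∣ B ∩ A ∣) ≡ F * g A * l
      column = begin
        ∑ As (λ B → f B * g A * ∣ B ∩ A ∣) ≡⟨ ∑-cong∈ As (λ {B} B∈ → cong (f B * g A *_)
                                                (trans (cong ∣_∣ (∩-comm B A)) (All.lookup A∩ B∈))) ⟩
        ∑ As (λ B → f B * g A * l)         ≡⟨ ∑-*ʳ As _ l ⟩
        ∑ As (λ B → f B * g A) * l         ≡⟨ cong (_* l) (∑-*ʳ As f (g A)) ⟩
        F * g A * l                        ∎

      lemma : ∀ a b l μ F G D → a * b * (l + μ) + a * G * l + (F * b * l + (l * (F * G) + μ * D)) ≡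
                                l * ((a + F) * (b + G)) + μ * (a * b + D)
      lemma = solve-∀

    module _ {As : List (Subset n)}
      (pairs : AllPairs (λ A B → ∣ A ∩ B ∣ ≡ l) As) (sizes : All (λ A → ∣ A ∣ ≡ l + μ) As) where

      -- The inner product of the combinations of members with coefficients f and g: exchanging the
      -- sums reduces it to `gram`.
      inner : ∀ f g →
        ∑ (allFin n) (λ y → ∑ As (λ A → f A * χ A y) * ∑ As (λ B → g B * χ B y)) ≡
        l * (∑ As f * ∑ As g) + μ * ∑ As (λ A → f A * g A)
      inner f g = begin
        ∑ (allFin n) (λ y → ∑ As (λ A → f A * χ A y) * ∑ As (λ B → g B * χ B y))
          ≡⟨ ∑-cong (allFin n) (λ y → ∑-* As As _ _) ⟩
        ∑ (allFin n) (λ y → ∑ As λ A → ∑ As λ B → f A * χ A y * (g B * χ B y))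
          ≡⟨ ∑-swap (allFin n) As _ ⟩
        ∑ As (λ A → ∑ (allFin n) λ y → ∑ As λ B → f A * χ A y * (g B * χ B y))
          ≡⟨ ∑-cong As (λ A → ∑-swap (allFin n) As _) ⟩
        ∑ As (λ A → ∑ As λ B → ∑ (allFin n) λ y → f A * χ A y * (g B * χ B y))
          ≡⟨ ∑-cong As (λ A → ∑-cong As λ B → entry A B) ⟩
        ∑ As (λ A → ∑ As λ B → f A * g B * ∣ A ∩ B ∣)
          ≡⟨ gram pairs sizes f g ⟩
        l * (∑ As f * ∑ As g) + μ * ∑ As (λ A → f A * g A) ∎
        where
        open ≡-Reasoning
        lemma : ∀ a b c d → a * b * (c * d) ≡ a * c * (b * d)
        lemma = solve-∀
        entry : ∀ A B → ∑ (allFin n) (λ y → f A * χ A y * (g B * χ B y)) ≡ f A * g B * ∣ A ∩ B ∣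
        entry A B = begin
          ∑ (allFin n) (λ y → f A * χ A y * (g B * χ B y))
            ≡⟨ ∑-cong (allFin n) (λ y → lemma (f A) (χ A y) (g B) (χ B y)) ⟩
          ∑ (allFin n) (λ y → f A * g B * (χ A y * χ B y))
            ≡⟨ ∑-*ˡ (allFin n) (f A * g B) _ ⟩
          f A * g B * ∑ (allFin n) (λ y → χ A y * χ B y)
            ≡⟨ cong (f A * g B *_) (∣∩∣≡∑ A B) ⟨
          f A * g B * ∣ A ∩ B ∣ ∎

      -- With d and e the degree and codegree of x, and u and v the sums of the members
      -- containing and avoiding x, the squared norm of e u - d v is μ d e (d + e),
      -- while its coordinate at x is d e.
      deg*codeg≤ : ∀ x → deg As x * codeg As x ≤ μ * (deg As x + codeg As x)
      -- Twice the inner product of e u and d v occurs on both sides of the expanded norm and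
      -- cancels. Then `cancel` removes one factor d e, treating d e = 0 apart.
      deg*codeg≤ x = cancel (d * e) (μ * (d + e)) (+-cancelˡ-≤ (2 * (e * d * (l * (d * e)))) _ _ (begin
        2 * (e * d * (l * (d * e))) + d * e * (d * e)
          ≤⟨ +-mono-≤ (≤-reflexive (cong (2 *_) (sym ⟨α,β⟩))) spike ⟩
        2 * ∑ (allFin n) (λ y → α y * β y) + ∑ (allFin n) (λ y → ∣ α y - β y ∣ * ∣ α y - β y ∣)
          ≡⟨ cong₂ _+_ (∑-*ˡ (allFin n) 2 _) refl ⟨
        ∑ (allFin n) (λ y → 2 * (α y * β y)) + ∑ (allFin n) (λ y → ∣ α y - β y ∣ * ∣ α y - β y ∣)
          ≡⟨ ∑-+ (allFin n) _ _ ⟨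
        ∑ (allFin n) (λ y → 2 * (α y * β y) + ∣ α y - β y ∣ * ∣ α y - β y ∣)
          ≡⟨ ∑-cong (allFin n) (λ y → a²+b² (α y) (β y)) ⟨
        ∑ (allFin n) (λ y → α y * α y + β y * β y)
          ≡⟨ ∑-+ (allFin n) _ _ ⟩
        ∑ (allFin n) (λ y → α y * α y) + ∑ (allFin n) (λ y → β y * β y)
          ≡⟨ cong₂ _+_ ⟨α,α⟩ ⟨β,β⟩ ⟩
        e * e * (l * (d * d) + μ * d) + d * d * (l * (e * e) + μ * e)
          ≡⟨ lemma d e l μ ⟩
        2 * (e * d * (l * (d * e))) + d * e * (μ * (d + e)) ∎))
        where
        open ≤-Reasoning
        d e : ℕ
        d = deg As x
        e = codeg As x

        u v : Fin n → ℕ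
        u y = ∑ As λ A → χ A x * χ A y
        v y = ∑ As λ A → χ (∁ A) x * χ A y

        α β : Fin n → ℕ
        α y = e * u y
        β y = d * v y

        cancel : ∀ a b → a * a ≤ a * b → a ≤ b
        cancel zero      b _     = z≤n
        cancel a@(suc _) b a²≤ab = *-cancelˡ-≤ a a²≤ab

        lemma : ∀ d e l μ → e * e * (l * (d * d) + μ * d) + d * d * (l * (e * e) + μ * e) ≡
                            2 * (e * d * (l * (d * e))) + d * e * (μ * (d + e))
        lemma = solve-∀

        scaled : ∀ a b (f g : Fin n → ℕ) →
          ∑ (allFin n) (λ y → a * f y * (b * g y)) ≡ a * b * ∑ (allFin n) (λ y → f y * g y)
        scaled a b f g = trans (∑-cong (allFin n) λ y → rearrange a (f y) b (g y)) (∑-*ˡ (allFin n) (a * b) _)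
          where
          rearrange : ∀ a f b g → a * f * (b * g) ≡ a * b * (f * g)
          rearrange = solve-∀

        ⟨α,α⟩ : ∑ (allFin n) (λ y → α y * α y) ≡ e * e * (l * (d * d) + μ * d)
        ⟨α,α⟩ = trans (scaled e e u u) (cong (e * e *_) (trans (inner _ _)
          (cong (λ s → l * (d * d) + μ * s) (∑-cong As λ A → χ-idem A x))))

        ⟨β,β⟩ : ∑ (allFin n) (λ y → β y * β y) ≡ d * d * (l * (e * e) + μ * e)
        ⟨β,β⟩ = trans (scaled d d v v) (cong (d * d *_) (trans (inner _ _)
          (cong (λ s → l * (e * e) + μ * s) (∑-cong As λ A → χ-idem (∁ A) x))))

        -- No member both contains and avoids x, so the μ term vanishes.
        ⟨α,β⟩ : ∑ (allFin n) (λ y → α y * β y) ≡ e * d * (l * (d * e))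
        ⟨α,β⟩ = trans (scaled e d u v) (cong (e * d *_) (trans (inner _ _) (trans
          (cong (λ s → l * (d * e) + μ * s) (trans (∑-cong As λ A → χ-∁-orth A x) (trans (∑-const As 0) (*-zeroʳ (length As)))))
          (trans (cong (l * (d * e) +_) (*-zeroʳ μ)) (+-identityʳ _)))))

        αx : α x ≡ d * e
        αx = trans (cong (e *_) (∑-cong As λ A → χ-idem A x)) (*-comm e d)

        βx : β x ≡ 0
        βx = trans (cong (d *_) (trans (∑-cong As λ A → trans (*-comm (χ (∁ A) x) _) (χ-∁-orth A x))
               (trans (∑-const As 0) (*-zeroʳ (length As))))) (*-zeroʳ d)

        spike : d * e * (d * e) ≤ ∑ (allFin n) (λ y → ∣ α y - β y ∣ * ∣ α y - β y ∣)
        spike = ≤-trans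
          (≤-reflexive (cong (λ s → s * s) (sym (trans (cong₂ ∣_-_∣ αx βx) (∣-∣-identityʳ (d * e))))))
          (∑-∈ (λ y → ∣ α y - β y ∣ * ∣ α y - β y ∣) (∈-allFin x))

  -- By integrality, an error smaller than m cannot make up for one whole multiple of m. This
  -- extracts exact cardinalities from averaged inequalities.
  crossover : ∀ {a b c m} → m * a ≤ m * b + c → c < m → a ≤ b
  crossover {a} {b} {c} {m} ma≤mb+c c<m = ≮⇒≥ λ b<a → <⇒≱ c<m (+-cancelˡ-≤ (m * b) m c (begin
    m * b + m    ≡⟨ +-comm (m * b) m ⟩
    m + m * b    ≡⟨ *-suc m b ⟨
    m * suc b    ≤⟨ *-monoʳ-≤ m b<a ⟩
    m * a        ≤⟨ ma≤mb+c ⟩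
    m * b + c    ∎))
    where open ≤-Reasoning

  -- Once one term equals 1, the vanishing products force all later terms to be 0.
  ∑≤1 : ∀ {f : X → ℕ} {xs} → (∀ x → f x ≤ 1) → AllPairs (λ x y → f x * f y ≡ 0) xs → ∑ xs f ≤ 1
  ∑≤1 f≤1 [] = z≤n
  ∑≤1 {f = f} {x ∷ xs} f≤1 (ps ∷ pss) with f x | f≤1 x
  ... | zero | _ = ∑≤1 f≤1 pss
  ... | suc (suc _) | s≤s ()
  ... | suc zero | _ = s≤s (≤-trans (∑-mono xs λ y∈ → ≤-reflexive (trans (sym (+-identityʳ _)) (All.lookup ps y∈)))
                         (≤-reflexive (trans (∑-const xs 0) (*-zeroʳ (length xs)))))

  χ≤1 : ∀ (A : Subset n) x → χ A x ≤ 1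
  χ≤1 A x with lookup A x
  ... | true  = ≤-refl
  ... | false = z≤n

  ∉⇒χ≡0 : ∀ {A : Subset n} {x} → x Subset.∉ A → χ A x ≡ 0
  ∉⇒χ≡0 {A = A} {x} x∉A with lookup A x in eq
  ... | true  = contradiction (lookup⇒[]= x A eq) x∉A
  ... | false = refl

  -- A point of H outside B would make H ∩ B a proper subset of H.
  ⊆-of-∣∩∣ : ∀ {H B : Subset n} → ∣ H ∣ ≤ ∣ H ∩ B ∣ → H Subset.⊆ B
  ⊆-of-∣∩∣ {H = H} {B} ∣H∣≤ {x} x∈H with x ∈? B
  ... | yes x∈B = x∈B
  ... | no  x∉B = contradiction ∣H∣≤ (<⇒≱ (p⊂q⇒∣p∣<∣q∣ (p∩q⊆p H B , x , x∈H , x∉B ∘ p∩q⊆q H B)))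

  -- H is contained in A ∩ B and at least as large, so a point of A ∩ B outside H is impossible.
  ∈-of-∣∩∣ : ∀ {H A B : Subset n} {x} → H Subset.⊆ A → H Subset.⊆ B → ∣ A ∩ B ∣ ≤ ∣ H ∣ →
    x Subset.∈ A → x Subset.∈ B → x Subset.∈ H
  ∈-of-∣∩∣ {H = H} {A} {B} {x} H⊆A H⊆B ∣A∩B∣≤ x∈A x∈B with x ∈? H
  ... | yes x∈H = x∈H
  ... | no  x∉H = contradiction ∣A∩B∣≤ (<⇒≱ (p⊂q⇒∣p∣<∣q∣
    ((λ y∈H → x∈p∩q⁺ (H⊆A y∈H , H⊆B y∈H)) , x , x∈p∩q⁺ (x∈A , x∈B) , x∉H)))

  -- The points lying in more than half of the members. For a large layer this turns out to be the
  -- kernel of a sunflower.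
  kernel : List (Subset n) → Subset n
  kernel As = Vec.tabulate λ x → does (codeg As x <? deg As x)

  ∑χ∩ : ∀ {n} (H A : Subset n) c → ∑ (allFin n) (λ y → c * χ H y * χ A y) ≡ c * ∣ H ∩ A ∣
  ∑χ∩ {n} H A c = trans (∑-cong (allFin n) λ y → *-assoc c (χ H y) (χ A y))
    (trans (∑-*ˡ (allFin n) c _) (cong (c *_) (sym (∣∩∣≡∑ H A))))

  ∑-χ-bound : ∀ {n} (H A : Subset n) a b →
    ∑ (allFin n) (λ y → (a * χ H y + b) * χ A y) ≡ a * ∣ H ∩ A ∣ + b * ∣ A ∣
  ∑-χ-bound {n} H A a b = trans (∑-cong (allFin n) λ y → *-distribʳ-+ (χ A y) (a * χ H y) b)
    (trans (∑-+ (allFin n) _ _) (cong₂ _+_ (∑χ∩ H A a)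
      (trans (∑-*ˡ (allFin n) b _) (cong (b *_) (sym (∣A∣≡∑χ A))))))

  -- Large uniform families are sunflowers

  module _ {l μ : ℕ} {As : List (Subset n)}
    (pairs : AllPairs (λ A B → ∣ A ∩ B ∣ ≡ l) As) (sizes : All (λ A → ∣ A ∣ ≡ l + μ) As)
    (1≤μ : 1 ≤ μ) (large : 2 * μ * (l + μ) + μ < length As) where

    private
      m : ℕ
      m = length As
      H : Subset n
      H = kernel As

      lookup≡ : ∀ {y} → lookup H y ≡ does (codeg As y <? deg As y)
      lookup≡ {y} = lookup∘tabulate _ y

      -- The product of degree and codegree is at most μ times their sum, so the smaller of the two
      -- is at most 2 μ.
      high-or-low : ∀ y → (χ H y ≡ 1 × codeg As y ≤ 2 * μ) ⊎ (χ H y ≡ 0 × deg As y ≤ 2 * μ)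
      high-or-low y with codeg As y <? deg As y
      ... | yes e<d = inj₁ (cong 𝟙 (trans lookup≡ (dec-true (codeg As y <? deg As y) e<d)) , m*n≤o*[m+n]⇒m≤2*o _ _ μ (<⇒≤ e<d)
        (subst₂ (λ a b → a ≤ μ * b) (*-comm (deg As y) (codeg As y)) (+-comm (deg As y) (codeg As y)) (deg*codeg≤ pairs sizes y)))
      ... | no  e≮d = inj₂ (cong 𝟙 (trans lookup≡ (dec-false (codeg As y <? deg As y) e≮d)) , m*n≤o*[m+n]⇒m≤2*o _ _ μ (≮⇒≥ e≮d) (deg*codeg≤ pairs sizes y))

      -- Together with `≤deg`: up to an error of 2 μ, the degree function is m times the indicator
      -- of H.
      deg≤ : ∀ y → deg As y ≤ m * χ H y + 2 * μ
      deg≤ y with high-or-low y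
      ... | inj₁ (eq , _) rewrite eq | *-identityʳ m =
        ≤-trans (≤-trans (m≤m+n (deg As y) (codeg As y)) (≤-reflexive (deg+codeg As y))) (m≤m+n m (2 * μ))
      ... | inj₂ (_ , d≤) = ≤-trans d≤ (m≤n+m (2 * μ) (m * χ H y))

      -- The summand 0 gives the left side the shape of `∑-χ-bound`.
      ≤deg : ∀ y → m * χ H y + 0 ≤ deg As y + 2 * μ
      ≤deg y with high-or-low y
      ... | inj₁ (eq , e≤) rewrite eq | *-identityʳ m | +-identityʳ m =
        ≤-trans (≤-reflexive (sym (deg+codeg As y))) (+-monoʳ-≤ (deg As y) e≤)
      ... | inj₂ (eq , _) rewrite eq | *-zeroʳ m = z≤n

      weighted : ∀ A → ∑ (allFin n) (λ y → (deg As y + 2 * μ) * χ A y) ≡ ∑ As (λ B → ∣ B ∩ A ∣) + 2 * μ * ∣ A ∣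
      weighted A = trans (∑-cong (allFin n) λ y → *-distribʳ-+ (χ A y) (deg As y) (2 * μ))
        (trans (∑-+ (allFin n) _ _) (cong₂ _+_ (sym (∑∣∩∣≡∑deg As A))
          (trans (∑-*ˡ (allFin n) (2 * μ) _) (cong (2 * μ *_) (sym (∣A∣≡∑χ A))))))

      upper : ∀ A → ∑ As (λ B → ∣ B ∩ A ∣) ≤ m * ∣ H ∩ A ∣ + 2 * μ * ∣ A ∣
      upper A = begin
        ∑ As (λ B → ∣ B ∩ A ∣)                             ≡⟨ ∑∣∩∣≡∑deg As A ⟩
        ∑ (allFin n) (λ y → deg As y * χ A y)               ≤⟨ ∑-mono (allFin n) (λ {y} _ → *-monoˡ-≤ (χ A y) (deg≤ y)) ⟩
        ∑ (allFin n) (λ y → (m * χ H y + 2 * μ) * χ A y)    ≡⟨ ∑-χ-bound H A m (2 * μ) ⟩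
        m * ∣ H ∩ A ∣ + 2 * μ * ∣ A ∣                       ∎
        where open ≤-Reasoning

      lower : ∀ A → m * ∣ H ∩ A ∣ ≤ ∑ As (λ B → ∣ B ∩ A ∣) + 2 * μ * ∣ A ∣
      lower A = begin
        m * ∣ H ∩ A ∣                                       ≡⟨ +-identityʳ _ ⟨
        m * ∣ H ∩ A ∣ + 0 * ∣ A ∣                           ≡⟨ ∑-χ-bound H A m 0 ⟨
        ∑ (allFin n) (λ y → (m * χ H y + 0) * χ A y)        ≤⟨ ∑-mono (allFin n) (λ {y} _ → *-monoˡ-≤ (χ A y) (≤deg y)) ⟩
        ∑ (allFin n) (λ y → (deg As y + 2 * μ) * χ A y)     ≡⟨ weighted A ⟩
        ∑ As (λ B → ∣ B ∩ A ∣) + 2 * μ * ∣ A ∣              ∎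
        where open ≤-Reasoning

      -- The member A contributes its own size l + μ, and every other member contributes l.
      row : ∀ {As : List (Subset n)} {A} → AllPairs (λ A B → ∣ A ∩ B ∣ ≡ l) As → All (λ A → ∣ A ∣ ≡ l + μ) As →
        A ∈ As → ∑ As (λ B → ∣ B ∩ A ∣) ≡ length As * l + μ
      row {A ∷ As} (A∩ ∷ ps) (∣A∣ ∷ ss) (here refl) = begin
        ∣ A ∩ A ∣ + ∑ As (λ B → ∣ B ∩ A ∣)  ≡⟨ cong₂ _+_ (trans (cong ∣_∣ (∩-idem A)) ∣A∣)
                                                (trans (∑-cong∈ As λ {B} B∈ → trans (cong ∣_∣ (∩-comm B A)) (All.lookup A∩ B∈))
                                                       (∑-const As l)) ⟩
        l + μ + length As * l               ≡⟨ lemma l μ (length As) ⟩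
        suc (length As) * l + μ             ∎
        where
        open ≡-Reasoning
        lemma : ∀ l μ m → l + μ + m * l ≡ suc m * l + μ
        lemma = solve-∀
      row {A ∷ As} (A∩ ∷ ps) (∣A∣ ∷ ss) (there B∈) =
        trans (cong₂ _+_ (All.lookup A∩ B∈) (row ps ss B∈)) (sym (+-assoc l _ μ))

      -- By `upper`, `lower` and `row`, both m |H ∩ A| and m l approximate the sum of |B ∩ A| over
      -- the members B. The hypothesis `large` is exactly what `crossover` asks of the error in the
      -- first inequality.
      ∣H∩A∣ : ∀ {A} → A ∈ As → ∣ H ∩ A ∣ ≡ l
      ∣H∩A∣ {A} A∈ = ≤-antisym
        (crossover (begin
          m * ∣ H ∩ A ∣                            ≤⟨ lower A ⟩
          ∑ As (λ B → ∣ B ∩ A ∣) + 2 * μ * ∣ A ∣   ≡⟨ cong₂ (λ s k → s + 2 * μ * k) (row pairs sizes A∈) (All.lookup sizes A∈) ⟩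
          m * l + μ + 2 * μ * (l + μ)              ≡⟨ +-assoc (m * l) μ _ ⟩
          m * l + (μ + 2 * μ * (l + μ))            ≡⟨ cong (m * l +_) (+-comm μ _) ⟩
          m * l + (2 * μ * (l + μ) + μ)            ∎) large)
        (crossover (begin
          m * l                                    ≤⟨ m≤m+n _ μ ⟩
          m * l + μ                                ≡⟨ row pairs sizes A∈ ⟨
          ∑ As (λ B → ∣ B ∩ A ∣)                   ≤⟨ upper A ⟩
          m * ∣ H ∩ A ∣ + 2 * μ * ∣ A ∣            ≡⟨ cong (λ k → m * ∣ H ∩ A ∣ + 2 * μ * k) (All.lookup sizes A∈) ⟩
          m * ∣ H ∩ A ∣ + 2 * μ * (l + μ)          ∎) (≤-<-trans (m≤m+n _ μ) large))
        where open ≤-Reasoning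

      ∣H∣≤l : ∣ H ∣ ≤ l
      -- Here `lower` is applied to H itself, and its error 2 μ |H| is absorbed on the left. This
      -- leaves the multiplier t = m - 2 μ and the error 2 μ l, which is below t.
      ∣H∣≤l = crossover {m = t} (+-cancelˡ-≤ (2 * μ * ∣ H ∣) _ _ (begin
        2 * μ * ∣ H ∣ + t * ∣ H ∣                  ≡⟨ *-distribʳ-+ ∣ H ∣ (2 * μ) t ⟨
        (2 * μ + t) * ∣ H ∣                        ≡⟨ cong₂ (λ a B → a * ∣ B ∣) 2μ+t≡m (sym (∩-idem H)) ⟩
        m * ∣ H ∩ H ∣                              ≤⟨ lower H ⟩
        ∑ As (λ B → ∣ B ∩ H ∣) + 2 * μ * ∣ H ∣     ≡⟨ cong (_+ 2 * μ * ∣ H ∣)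
                                                      (trans (∑-cong∈ As (λ {B} B∈ → trans (cong ∣_∣ (∩-comm B H)) (∣H∩A∣ B∈))) (∑-const As l)) ⟩
        m * l + 2 * μ * ∣ H ∣                      ≡⟨ cong (λ s → s * l + 2 * μ * ∣ H ∣) 2μ+t≡m ⟨
        (2 * μ + t) * l + 2 * μ * ∣ H ∣            ≡⟨ lemma (2 * μ) t l ∣ H ∣ ⟩
        2 * μ * ∣ H ∣ + (t * l + 2 * μ * l)        ∎))
        (+-cancelˡ-< (2 * μ) _ _ (begin-strict
          2 * μ + 2 * μ * l     ≡⟨ *-suc (2 * μ) l ⟨
          2 * μ * suc l         ≡⟨ cong (2 * μ *_) (+-comm 1 l) ⟩
          2 * μ * (l + 1)       ≤⟨ *-monoʳ-≤ (2 * μ) (+-monoʳ-≤ l 1≤μ) ⟩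
          2 * μ * (l + μ)       ≤⟨ m≤m+n _ μ ⟩
          2 * μ * (l + μ) + μ   <⟨ large ⟩
          m                     ≡⟨ 2μ+t≡m ⟨
          2 * μ + t             ∎))
        where
        open ≤-Reasoning
        2μ≤m : 2 * μ ≤ m
        2μ≤m = begin
          2 * μ                 ≡⟨ *-identityʳ (2 * μ) ⟨
          2 * μ * 1             ≤⟨ *-monoʳ-≤ (2 * μ) (≤-trans 1≤μ (m≤n+m μ l)) ⟩
          2 * μ * (l + μ)       ≤⟨ m≤m+n _ μ ⟩
          2 * μ * (l + μ) + μ   ≤⟨ <⇒≤ large ⟩
          m                     ∎
        t : ℕ
        t = proj₁ (m≤n⇒∃[o]m+o≡n 2μ≤m)
        2μ+t≡m : 2 * μ + t ≡ m
        2μ+t≡m = proj₂ (m≤n⇒∃[o]m+o≡n 2μ≤m)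
        lemma : ∀ a t l h → (a + t) * l + a * h ≡ a * h + (t * l + a * l)
        lemma = solve-∀

      H⊆ : ∀ {A} → A ∈ As → H Subset.⊆ A
      H⊆ A∈ = ⊆-of-∣∩∣ (≤-trans ∣H∣≤l (≤-reflexive (sym (∣H∩A∣ A∈))))

    ∣kernel∣ : ∣ kernel As ∣ ≡ l
    -- Any member A gives l = |H ∩ A| ≤ |H|, and `large` guarantees that there is one.
    ∣kernel∣ = ≤-antisym ∣H∣≤l (l≤∣H∣ As id (≤-trans (s≤s z≤n) large))
      where
      l≤∣H∣ : ∀ Bs → (∀ {A} → A ∈ Bs → A ∈ As) → 0 < length Bs → l ≤ ∣ H ∣
      l≤∣H∣ (A ∷ _) ⊆As _ = subst (_≤ ∣ H ∣) (∣H∩A∣ (⊆As (here refl))) (p⊆q⇒∣p∣≤∣q∣ (p∩q⊆p H A))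

    -- Two members share l points and the kernel already supplies all of them, so the petals are
    -- disjoint. Off the kernel this sharpens the error 2 μ of `deg≤` to 1.
    deg≤kernel+1 : ∀ x → deg As x ≤ length As * χ (kernel As) x + 1
    deg≤kernel+1 x with x ∈? H
    ... | yes x∈H rewrite []=⇒lookup x∈H | *-identityʳ m =
      ≤-trans (≤-trans (m≤m+n (deg As x) (codeg As x)) (≤-reflexive (deg+codeg As x))) (m≤m+n m 1)
    ... | no  x∉H = ≤-trans (∑≤1 (λ A → χ≤1 A x) (petals As pairs id)) (m≤n+m 1 _)
      where
      disjoint : ∀ {A B} → A ∈ As → B ∈ As → ∣ A ∩ B ∣ ≡ l → χ A x * χ B x ≡ 0
      disjoint {A} {B} A∈ B∈ ∣A∩B∣≡l = trans (sym (χ-∩ A B x)) (∉⇒χ≡0 λ x∈A∩B →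
        x∉H (∈-of-∣∩∣ (H⊆ A∈) (H⊆ B∈) (≤-reflexive (trans ∣A∩B∣≡l (sym ∣kernel∣)))
          (p∩q⊆p A B x∈A∩B) (p∩q⊆q A B x∈A∩B)))
      petals : ∀ Bs → AllPairs (λ A B → ∣ A ∩ B ∣ ≡ l) Bs → (∀ {A} → A ∈ Bs → A ∈ As) →
        AllPairs (λ A B → χ A x * χ B x ≡ 0) Bs
      petals []       []        _   = []
      petals (A ∷ Bs) (ps ∷ pss) ⊆As =
        All.tabulate (λ B∈ → disjoint (⊆As (here refl)) (⊆As (there B∈)) (All.lookup ps B∈)) ∷
        petals Bs pss (⊆As ∘ there)

    -- The disjoint petals meet B in at most |B| points altogether, fewer than one per member. The
    -- average intersection l must therefore come from the kernel.
    kernel⊆ : ∀ {B} → ∣ B ∣ < length As → (∀ {A} → A ∈ As → l ≤ ∣ A ∩ B ∣) → kernel As Subset.⊆ B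
    kernel⊆ {B} ∣B∣<m l≤ = ⊆-of-∣∩∣ (≤-trans (≤-reflexive ∣kernel∣) (crossover (begin
      m * l                                         ≡⟨ ∑-const As l ⟨
      ∑ As (λ _ → l)                                ≤⟨ ∑-mono As l≤ ⟩
      ∑ As (λ A → ∣ A ∩ B ∣)                        ≡⟨ ∑∣∩∣≡∑deg As B ⟩
      ∑ (allFin n) (λ y → deg As y * χ B y)         ≤⟨ ∑-mono (allFin n) (λ {y} _ → *-monoˡ-≤ (χ B y) (deg≤kernel+1 y)) ⟩
      ∑ (allFin n) (λ y → (m * χ H y + 1) * χ B y)  ≡⟨ ∑-χ-bound H B m 1 ⟩
      m * ∣ H ∩ B ∣ + 1 * ∣ B ∣                     ≡⟨ cong (m * ∣ H ∩ B ∣ +_) (*-identityˡ ∣ B ∣) ⟩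
      m * ∣ H ∩ B ∣ + ∣ B ∣                         ∎) ∣B∣<m))
      where open ≤-Reasoning

  -- Families over several sizes

  -- The sum is grouped by the value of `s`, for which there are M possibilities.
  ∑-fibres≤ : ∀ (xs : List X) (f s : X → ℕ) {M c} → (∀ {x} → x ∈ xs → s x < M) →
    (∀ i → ∑ xs (λ x → f x * 𝟙 (does (s x ≟ i))) ≤ c) → ∑ xs f ≤ M * c
  ∑-fibres≤ xs f s {M} {c} s<M fibre≤c = begin
    ∑ xs f                                                      ≤⟨ ∑-mono xs (λ {x} x∈ → begin
      f x                                       ≡⟨ *-identityʳ (f x) ⟨
      f x * 1                                   ≡⟨ cong (λ t → f x * 𝟙 t) (dec-true (s x ≟ s x) refl) ⟨
      f x * 𝟙 (does (s x ≟ s x))                ≤⟨ ∑-∈ (λ i → f x * 𝟙 (does (s x ≟ i))) (∈-upTo⁺ (s<M x∈)) ⟩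
      ∑ (upTo M) (λ i → f x * 𝟙 (does (s x ≟ i))) ∎) ⟩
    ∑ xs (λ x → ∑ (upTo M) λ i → f x * 𝟙 (does (s x ≟ i)))     ≡⟨ ∑-swap xs (upTo M) _ ⟩
    ∑ (upTo M) (λ i → ∑ xs λ x → f x * 𝟙 (does (s x ≟ i)))     ≤⟨ ∑-mono (upTo M) (λ {i} _ → fibre≤c i) ⟩
    ∑ (upTo M) (λ _ → c)                                        ≡⟨ ∑-const (upTo M) c ⟩
    length (upTo M) * c                                         ≡⟨ cong (_* c) (length-upTo M) ⟩
    M * c                                                       ∎
    where open ≤-Reasoning

  AllPairs-map∈ : ∀ {R S : X → X → Set} {xs} → (∀ {x y} → x ∈ xs → y ∈ xs → R x y → S x y) →
    AllPairs R xs → AllPairs S xs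
  AllPairs-map∈ f []         = []
  AllPairs-map∈ f (ps ∷ pss) =
    All.tabulate (λ y∈ → f (here refl) (there y∈) (All.lookup ps y∈)) ∷
    AllPairs-map∈ (λ x∈ y∈ → f (there x∈) (there y∈)) pss

  -- With q = L / s: the sizes are distinct and at most (b / a) s₀ for any one size s₀,
  -- so there are O(s₀) of them, and each term is at most b L / (a s₀).
  ∑-reciprocals≤ : ∀ (xs : List X) (s q : X → ℕ) {a b L} → 0 < a → 0 < b →
    (∀ {x} → x ∈ xs → 0 < s x) → (∀ {x} → x ∈ xs → q x * s x ≡ L) →
    AllPairs (λ x y → s x ≢ s y) xs →
    (∀ {x y} → x ∈ xs → y ∈ xs → a * s x ≤ b * s y) →
    a * ∑ xs q ≤ 2 * b * b * L
  ∑-reciprocals≤ [] s q {a} 0<a 0<b 0<s qs≡L distinct ratio rewrite *-zeroʳ a = z≤n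
  ∑-reciprocals≤ xs@(h ∷ _) s q {a} {b} {L} 0<a 0<b 0<s qs≡L distinct ratio =
    *-cancelʳ-≤ (a * ∑ xs q) (2 * b * b * L) (s h) {{>-nonZero (0<s (here refl))}} (begin
      a * ∑ xs q * s h                   ≡⟨ lemma₁ a (∑ xs q) (s h) ⟩
      a * s h * ∑ xs q                   ≡⟨ ∑-*ˡ xs (a * s h) q ⟨
      ∑ xs (λ x → a * s h * q x)         ≤⟨ ∑-mono xs (λ {x} x∈ → begin
        a * s h * q x     ≤⟨ *-monoˡ-≤ (q x) (ratio (here refl) x∈) ⟩
        b * s x * q x     ≡⟨ lemma₂ b (s x) (q x) ⟩
        b * (q x * s x)   ≡⟨ cong (b *_) (qs≡L x∈) ⟩
        b * L             ∎) ⟩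
      ∑ xs (λ _ → b * L)                 ≡⟨ ∑-const xs (b * L) ⟩
      length xs * (b * L)                ≤⟨ *-monoˡ-≤ (b * L) length≤ ⟩
      2 * (b * s h) * (b * L)            ≡⟨ lemma₃ b (s h) L ⟩
      2 * b * b * L * s h                ∎)
    where
    open ≤-Reasoning
    lemma₁ : ∀ a q s → a * q * s ≡ a * s * q
    lemma₁ = solve-∀
    lemma₂ : ∀ b s q → b * s * q ≡ b * (q * s)
    lemma₂ = solve-∀
    lemma₃ : ∀ b s L → 2 * (b * s) * (b * L) ≡ 2 * b * b * L * s
    lemma₃ = solve-∀

    𝟙≤1 : ∀ t → 𝟙 t ≤ 1
    𝟙≤1 true  = ≤-refl
    𝟙≤1 false = z≤n

    fibre≤1 : ∀ i → ∑ xs (λ x → 1 * 𝟙 (does (s x ≟ i))) ≤ 1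
    fibre≤1 i = ∑≤1 (λ x → ≤-trans (≤-reflexive (*-identityˡ _)) (𝟙≤1 _)) (AllPairs-map∈ (λ {x} {y} _ _ → disjoint (s x ≟ i) (s y ≟ i)) distinct)
      where
      disjoint : ∀ {x y} (d : Dec (s x ≡ i)) (e : Dec (s y ≡ i)) → s x ≢ s y →
        1 * 𝟙 (does d) * (1 * 𝟙 (does e)) ≡ 0
      disjoint (yes sx≡i) (yes sy≡i) sx≢sy = contradiction (trans sx≡i (sym sy≡i)) sx≢sy
      disjoint (yes _)    (no _)     _     = refl
      disjoint (no _)     _          _     = refl

    s≤ : ∀ {x} → x ∈ xs → s x ≤ b * s h
    s≤ {x} x∈ = begin
      s x         ≡⟨ *-identityˡ (s x) ⟨
      1 * s x     ≤⟨ *-monoˡ-≤ (s x) 0<a ⟩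
      a * s x     ≤⟨ ratio x∈ (here refl) ⟩
      b * s h     ∎

    length≤ : length xs ≤ 2 * (b * s h)
    length≤ = begin
      length xs                 ≡⟨ *-identityʳ _ ⟨
      length xs * 1             ≡⟨ ∑-const xs 1 ⟨
      ∑ xs (λ _ → 1)            ≤⟨ ∑-fibres≤ xs (λ _ → 1) s (λ x∈ → s≤s (s≤ x∈)) fibre≤1 ⟩
      suc (b * s h) * 1         ≡⟨ *-identityʳ _ ⟩
      -- The candidate sizes start at 0; the extra value is absorbed by b * s h ≥ 1.
      1 + b * s h               ≤⟨ +-mono-≤ (*-mono-≤ 0<b (0<s (here refl))) (≤-reflexive (sym (+-identityʳ _))) ⟩
      2 * (b * s h)             ∎

  ∣∩∣+∣∩∁∣ : ∀ (A B : Subset n) → ∣ A ∩ B ∣ + ∣ A ∩ ∁ B ∣ ≡ ∣ A ∣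
  ∣∩∣+∣∩∁∣ {n} A B = begin
    ∣ A ∩ B ∣ + ∣ A ∩ ∁ B ∣                                   ≡⟨ cong₂ _+_ (∣∩∣≡∑ A B) (∣∩∣≡∑ A (∁ B)) ⟩
    ∑ (allFin n) _ + ∑ (allFin n) _                           ≡⟨ ∑-+ (allFin n) _ _ ⟨
    ∑ (allFin n) (λ x → χ A x * χ B x + χ A x * χ (∁ B) x)    ≡⟨ ∑-cong (allFin n) (λ x → begin
      χ A x * χ B x + χ A x * χ (∁ B) x   ≡⟨ *-distribˡ-+ (χ A x) _ _ ⟨
      χ A x * (χ B x + χ (∁ B) x)         ≡⟨ cong (χ A x *_) (χ-∁ B x) ⟩
      χ A x * 1                           ≡⟨ *-identityʳ _ ⟩
      χ A x                               ∎) ⟩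
    ∑ (allFin n) (χ A)                                        ≡⟨ ∣A∣≡∑χ A ⟨
    ∣ A ∣                                                     ∎
    where open ≡-Reasoning

  -- Layers of a θ-intersecting family, with θ = a / b

  module _ {a b : ℕ} (0<a : 0 < a) (a<b : a < b) {As : List (Subset n)} (unique : Unique As) {V : ℕ}
    (0<∣_∣ : ∀ {A} → A ∈ As → 0 < ∣ A ∣) (∣_∣≤V : ∀ {A} → A ∈ As → ∣ A ∣ ≤ V)
    (intersecting : ∀ {A B} → A ∈ As → B ∈ As → A ≢ B → b * ∣ A ∩ B ∣ ≡ a * ∣ A ∣ ⊎ b * ∣ A ∩ B ∣ ≡ a * ∣ B ∣) where

    private
      0<b : 0 < b
      0<b = ≤-<-trans z≤n a<b

      instance
        b≢0 : NonZero b
        b≢0 = >-nonZero 0<b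

      layer : ℕ → List (Subset n)
      layer k = filter (λ A → ∣ A ∣ ≟ k) As

      -- The threshold is the same for all layers. As sizes are at most V, it dominates both the
      -- error 2 μ (l + μ) + μ of the sunflower argument and the size of any member.
      Large : ℕ → Set
      Large k = 3 * (V * V) < length (layer k)

      large? : ∀ k → Dec (Large k)
      large? k = 3 * (V * V) <? length (layer k)

      K : ℕ → Subset n
      K k = kernel (layer k)

      ∈-layer : ∀ {k A} → A ∈ layer k → A ∈ As × ∣ A ∣ ≡ k
      ∈-layer = ∈-filter⁻ (λ A → ∣ A ∣ ≟ _)

      layer-unique : ∀ k → Unique (layer k)
      layer-unique k = AllPairs.filter⁺ (λ A → ∣ A ∣ ≟ k) unique

      -- Equal sizes make the two alternatives of `intersecting` coincide.
      ∣∩∣-layer : ∀ {k A B} → A ∈ layer k → B ∈ layer k → A ≢ B → b * ∣ A ∩ B ∣ ≡ a * k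
      ∣∩∣-layer A∈ B∈ A≢B with ∈-layer A∈ | ∈-layer B∈
      ... | A∈As , refl | B∈As , ∣B∣≡k with intersecting A∈As B∈As A≢B
      ...   | inj₁ eq = eq
      ...   | inj₂ eq = trans eq (cong (a *_) ∣B∣≡k)

      -- The data for the sunflower argument. Here l is θ k, which is known to be an integer once
      -- two distinct members realise it as the size of their intersection; `uniform` starts from
      -- such a pair.
      record Uniform (k : ℕ) : Set where
        field
          l μ   : ℕ
          1≤μ   : 1 ≤ μ
          k≡l+μ : k ≡ l + μ
          k≤V   : k ≤ V
          bl≡ak : b * l ≡ a * k
          pairs : AllPairs (λ A B → ∣ A ∩ B ∣ ≡ l) (layer k)
          sizes : All (λ A → ∣ A ∣ ≡ l + μ) (layer k)

      uniform : ∀ {k A B} → A ∈ layer k → B ∈ layer k → A ≢ B → Uniform k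
      uniform {k} {A} {B} A∈ B∈ A≢B = record
        { l     = l
        ; μ     = proj₁ split
        ; 1≤μ   = +-cancelˡ-≤ l _ _ (≤-trans (≤-trans (≤-reflexive (+-comm l 1)) l<k) (≤-reflexive (sym (proj₂ split))))
        ; k≡l+μ = sym (proj₂ split)
        ; k≤V   = subst (_≤ V) (proj₂ (∈-layer A∈)) ∣ proj₁ (∈-layer A∈) ∣≤V
        ; bl≡ak = bl≡ak
        ; pairs = AllPairs-map∈ (λ C∈ D∈ C≢D → *-cancelˡ-≡ _ _ b (trans (∣∩∣-layer C∈ D∈ C≢D) (sym bl≡ak))) (layer-unique k)
        ; sizes = All.tabulate λ C∈ → trans (proj₂ (∈-layer C∈)) (sym (proj₂ split))
        }
        where
        l : ℕ
        l = ∣ A ∩ B ∣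
        bl≡ak : b * l ≡ a * k
        bl≡ak = ∣∩∣-layer A∈ B∈ A≢B
        0<k : 0 < k
        0<k = subst (0 <_) (proj₂ (∈-layer A∈)) 0<∣ proj₁ (∈-layer A∈) ∣
        -- This is where θ < 1 and the nonemptiness of members enter; it makes μ positive.
        l<k : l < k
        l<k = *-cancelˡ-< b _ _ (subst (_< b * k) (sym bl≡ak) (*-monoˡ-< k {{>-nonZero 0<k}} a<b))
        split : ∃ λ μ → l + μ ≡ k
        split = m≤n⇒∃[o]m+o≡n (<⇒≤ l<k)

      two : ∀ {P : Set} (Bs : List (Subset n)) → Unique Bs → 2 ≤ length Bs →
        (∀ {A B} → A ∈ Bs → B ∈ Bs → A ≢ B → P) → P
      two (A ∷ B ∷ _) ((A≢B ∷ _) ∷ _) _ f = f (here refl) (there (here refl)) A≢B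
      two (_ ∷ []) _ (s≤s ()) _

      V≤V² : V ≤ V * V
      V≤V² = m≤m² V
        where
        m≤m² : ∀ m → m ≤ m * m
        m≤m² zero    = z≤n
        m≤m² (suc m) = m≤m+n (suc m) _

      large⇒uniform : ∀ {A} → A ∈ As → Large ∣ A ∣ → Uniform ∣ A ∣
      large⇒uniform A∈ large = two (layer _) (layer-unique _)
        -- A nonempty member forces V ≥ 1, so the threshold is at least 1 and a large layer has two
        -- members.
        (≤-<-trans (*-mono-≤ {1} {3} (s≤s z≤n) (≤-trans (≤-trans 0<∣ A∈ ∣ ∣ A∈ ∣≤V) V≤V²)) large) uniform

      module _ {k} (uni : Uniform k) (large : Large k) where
        open Uniform uni

        threshold : 2 * μ * (l + μ) + μ < length (layer k)
        threshold = ≤-<-trans (begin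
          2 * μ * (l + μ) + μ      ≤⟨ +-mono-≤ (*-mono-≤ (*-monoʳ-≤ 2 μ≤V) (subst (_≤ V) k≡l+μ k≤V)) (≤-trans μ≤V V≤V²) ⟩
          2 * V * V + V * V        ≡⟨ lemma V ⟩
          3 * (V * V)              ∎) large
          where
          open ≤-Reasoning
          μ≤V : μ ≤ V
          μ≤V = ≤-trans (m≤n+m μ l) (subst (_≤ V) k≡l+μ k≤V)
          lemma : ∀ V → 2 * V * V + V * V ≡ 3 * (V * V)
          lemma = solve-∀

        b∣K∣≡ak : b * ∣ K k ∣ ≡ a * k
        b∣K∣≡ak = trans (cong (b *_) (∣kernel∣ pairs sizes 1≤μ threshold)) bl≡ak

        -- Under either alternative of `intersecting`, B meets each member of the layer in at least
        -- θ k = l points, so `kernel⊆` applies.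
        K⊆ : ∀ {B} → B ∈ As → k ≤ ∣ B ∣ → K k Subset.⊆ B
        K⊆ {B} B∈ k≤∣B∣ = kernel⊆ pairs sizes 1≤μ threshold
          (≤-<-trans (≤-trans (≤-trans ∣ B∈ ∣≤V V≤V²) (m≤m+n (V * V) _)) large) l≤
          where
          open ≤-Reasoning
          l≤ : ∀ {A} → A ∈ layer k → l ≤ ∣ A ∩ B ∣
          l≤ {A} A∈ with ≡-dec _≟ᵇ_ A B
          ... | yes refl = ≤-trans (m≤m+n l μ) (≤-reflexive
                  (trans (sym (All.lookup sizes A∈)) (cong ∣_∣ (sym (∩-idem A)))))
          ... | no  A≢B with ∈-layer A∈
          ...   | A∈As , refl with intersecting A∈As B∈ A≢B
          ...     | inj₁ eq = *-cancelˡ-≤ b (≤-reflexive (trans bl≡ak (sym eq)))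
          ...     | inj₂ eq = *-cancelˡ-≤ b (begin
                      b * l           ≡⟨ bl≡ak ⟩
                      a * k           ≤⟨ *-monoʳ-≤ a k≤∣B∣ ⟩
                      a * ∣ B ∣       ≡⟨ eq ⟨
                      b * ∣ A ∩ B ∣   ∎)

      -- Petals in large layers and the charging argument

      G : List (Subset n)
      G = filter (λ A → large? ∣ A ∣) As

      ∈-G : ∀ {A} → A ∈ G → A ∈ As × Large ∣ A ∣
      ∈-G = ∈-filter⁻ (λ A → large? ∣ A ∣)

      petal : Subset n → Subset n
      petal A = A ∩ ∁ (K ∣ A ∣)

      -- The kernel takes at most a |A| / b points of A, and a + 1 ≤ b leaves at least |A| / b of
      -- them to the petal.
      ∣A∣≤b∣petal∣ : ∀ {A} → A ∈ G → ∣ A ∣ ≤ b * ∣ petal A ∣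
      ∣A∣≤b∣petal∣ {A} A∈G = let A∈ , large = ∈-G A∈G in
        +-cancelˡ-≤ (a * ∣ A ∣) _ _ (begin
          a * ∣ A ∣ + ∣ A ∣                            ≡⟨ +-comm _ ∣ A ∣ ⟩
          suc a * ∣ A ∣                                ≤⟨ *-monoˡ-≤ ∣ A ∣ a<b ⟩
          b * ∣ A ∣                                    ≡⟨ cong (b *_) (∣∩∣+∣∩∁∣ A (K ∣ A ∣)) ⟨
          b * (∣ A ∩ K ∣ A ∣ ∣ + ∣ petal A ∣)          ≡⟨ *-distribˡ-+ b _ _ ⟩
          b * ∣ A ∩ K ∣ A ∣ ∣ + b * ∣ petal A ∣        ≤⟨ +-monoˡ-≤ _ (*-monoʳ-≤ b (∣p∩q∣≤∣q∣ A (K ∣ A ∣))) ⟩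
          b * ∣ K ∣ A ∣ ∣ + b * ∣ petal A ∣            ≡⟨ cong (_+ b * ∣ petal A ∣) (b∣K∣≡ak (large⇒uniform A∈ large) large) ⟩
          a * ∣ A ∣ + b * ∣ petal A ∣                  ∎)
        where open ≤-Reasoning

      -- If A and B met in θ |A| points, their intersection would be the kernel of the layer of A,
      -- which misses x. Hence they meet in θ |B| points, which excludes equal sizes and gives θ |B|
      -- ≤ |A|.
      common-petal : ∀ {A B x} → A ∈ G → B ∈ G → A ≢ B → x Subset.∈ petal A → x Subset.∈ petal B → ∣ A ∣ ≤ ∣ B ∣ →
        ∣ A ∣ ≢ ∣ B ∣ × a * ∣ B ∣ ≤ b * ∣ A ∣
      common-petal {A} {B} {x} A∈G B∈G A≢B x∈PA x∈PB ∣A∣≤∣B∣ =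
        (λ ∣A∣≡∣B∣ → not-λ (trans b∣A∩B∣ (cong (a *_) (sym ∣A∣≡∣B∣)))) ,
        ≤-trans (≤-reflexive (sym b∣A∩B∣)) (*-monoʳ-≤ b (∣p∩q∣≤∣p∣ A B))
        where
        A∈ = proj₁ (∈-G A∈G)
        B∈ = proj₁ (∈-G B∈G)
        large = proj₂ (∈-G A∈G)
        uni = large⇒uniform A∈ large

        not-λ : b * ∣ A ∩ B ∣ ≢ a * ∣ A ∣
        not-λ eq = x∈∁p⇒x∉p (p∩q⊆q A _ x∈PA) (∈-of-∣∩∣ (K⊆ uni large A∈ ≤-refl) (K⊆ uni large B∈ ∣A∣≤∣B∣)
          (≤-reflexive (*-cancelˡ-≡ _ _ b (trans eq (sym (b∣K∣≡ak uni large)))))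
          (p∩q⊆p A _ x∈PA) (p∩q⊆p B _ x∈PB))

        b∣A∩B∣ : b * ∣ A ∩ B ∣ ≡ a * ∣ B ∣
        b∣A∩B∣ with intersecting A∈ B∈ A≢B
        ... | inj₁ eq = contradiction eq not-λ
        ... | inj₂ eq = eq

      -- Weights V! / ∣ A ∣, proportional to 1 / ∣ A ∣ but integral; quot L 0 is junk.
      quot : ℕ → ℕ → ℕ
      quot L zero    = 0
      quot L (suc k) = L / suc k

      -- The division is exact because k divides k !, which divides V !.
      quot* : ∀ {k} → 0 < k → k ≤ V → quot (V !) k * k ≡ V !
      quot* {suc k} _ k≤V = sym (trans (m≡m%n+[m/n]*n (V !) (suc k))
        (cong (_+ V ! / suc k * suc k) (n∣m⇒m%n≡0 (V !) (suc k) (∣-trans (m∣m*n (k !)) (m≤n⇒m!∣n! k≤V)))))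

      q : Subset n → ℕ
      q A = quot (V !) ∣ A ∣

      G∋ : Fin n → List (Subset n)
      G∋ x = filter (λ A → x ∈? petal A) G

      -- By `common-petal`, the members whose petals contain x have distinct sizes within a factor b
      -- / a of one another, as `∑-reciprocals≤` requires.
      through : ∀ x → a * ∑ (G∋ x) q ≤ 2 * b * b * V !
      through x = ∑-reciprocals≤ (G∋ x) ∣_∣ q 0<a 0<b
        (λ A∈ → 0<∣ ∈As A∈ ∣) (λ A∈ → quot* 0<∣ ∈As A∈ ∣ ∣ ∈As A∈ ∣≤V)
        (AllPairs-map∈ distinct-sizes (AllPairs.filter⁺ _ (AllPairs.filter⁺ _ unique)))
        ratio
        where
        ∈G∋ : ∀ {A} → A ∈ G∋ x → A ∈ G × x Subset.∈ petal A
        ∈G∋ = ∈-filter⁻ (λ A → x ∈? petal A)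
        ∈As : ∀ {A} → A ∈ G∋ x → A ∈ As
        ∈As A∈ = proj₁ (∈-G (proj₁ (∈G∋ A∈)))

        distinct-sizes : ∀ {A B} → A ∈ G∋ x → B ∈ G∋ x → A ≢ B → ∣ A ∣ ≢ ∣ B ∣
        distinct-sizes A∈ B∈ A≢B ∣A∣≡∣B∣ =
          proj₁ (common-petal (proj₁ (∈G∋ A∈)) (proj₁ (∈G∋ B∈)) A≢B (proj₂ (∈G∋ A∈)) (proj₂ (∈G∋ B∈)) (≤-reflexive ∣A∣≡∣B∣)) ∣A∣≡∣B∣

        ratio : ∀ {A B} → A ∈ G∋ x → B ∈ G∋ x → a * ∣ A ∣ ≤ b * ∣ B ∣
        ratio {A} {B} A∈ B∈ with ∣ A ∣ ≤? ∣ B ∣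
        ... | yes ∣A∣≤∣B∣ = *-mono-≤ (<⇒≤ a<b) ∣A∣≤∣B∣
        ... | no  ∣A∣≰∣B∣ = proj₂ (common-petal (proj₁ (∈G∋ B∈)) (proj₁ (∈G∋ A∈)) (λ { refl → ∣A∣≰∣B∣ ≤-refl })
                (proj₂ (∈G∋ B∈)) (proj₂ (∈G∋ A∈)) (≰⇒≥ ∣A∣≰∣B∣))

      -- Double counting of the charge b * q A that A sends to each point of its petal: a member
      -- sends at least V ! in total, and a point receives at most 2 b³ V ! / a.
      length-G≤ : length G ≤ 2 * b * b * b * n
      length-G≤ = *-cancelʳ-≤ (length G) (2 * b * b * b * n) (V !) {{V !≢0}} (begin
        length G * V !                                                   ≤⟨ m≤n*m (length G * V !) a {{>-nonZero 0<a}} ⟩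
        a * (length G * V !)                                             ≡⟨ cong (a *_) (∑-const G (V !)) ⟨
        a * ∑ G (λ _ → V !)                                              ≤⟨ *-monoʳ-≤ a (∑-mono G charge) ⟩
        a * ∑ G (λ A → ∑ (allFin n) λ x → b * (χ (petal A) x * q A))     ≡⟨ cong (a *_) (∑-swap G (allFin n) _) ⟩
        a * ∑ (allFin n) (λ x → ∑ G λ A → b * (χ (petal A) x * q A))     ≡⟨ ∑-*ˡ (allFin n) a _ ⟨
        ∑ (allFin n) (λ x → a * ∑ G λ A → b * (χ (petal A) x * q A))     ≤⟨ ∑-mono (allFin n) (λ {x} _ → column x) ⟩
        ∑ (allFin n) (λ x → b * (2 * b * b * V !))                       ≡⟨ ∑-const (allFin n) _ ⟩
        length (allFin n) * (b * (2 * b * b * V !))                      ≡⟨ cong (_* (b * (2 * b * b * V !))) (length-tabulate {n = n} id) ⟩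
        n * (b * (2 * b * b * V !))                                      ≡⟨ lemma n b (V !) ⟩
        2 * b * b * b * n * V !                                          ∎)
        where
        open ≤-Reasoning
        lemma : ∀ n b L → n * (b * (2 * b * b * L)) ≡ 2 * b * b * b * n * L
        lemma = solve-∀

        charge : ∀ {A} → A ∈ G → V ! ≤ ∑ (allFin n) (λ x → b * (χ (petal A) x * q A))
        charge {A} A∈G = begin
          V !                                                  ≡⟨ quot* 0<∣ proj₁ (∈-G A∈G) ∣ ∣ proj₁ (∈-G A∈G) ∣≤V ⟨
          q A * ∣ A ∣                                          ≤⟨ *-monoʳ-≤ (q A) (∣A∣≤b∣petal∣ A∈G) ⟩
          q A * (b * ∣ petal A ∣)                              ≡⟨ lemma′ (q A) b ∣ petal A ∣ ⟩
          b * (∣ petal A ∣ * q A)                              ≡⟨ cong (λ s → b * (s * q A)) (∣A∣≡∑χ (petal A)) ⟩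
          b * (∑ (allFin n) (χ (petal A)) * q A)               ≡⟨ cong (b *_) (∑-*ʳ (allFin n) _ (q A)) ⟨
          b * ∑ (allFin n) (λ x → χ (petal A) x * q A)         ≡⟨ ∑-*ˡ (allFin n) b _ ⟨
          ∑ (allFin n) (λ x → b * (χ (petal A) x * q A))       ∎
          where
          lemma′ : ∀ q b p → q * (b * p) ≡ b * (p * q)
          lemma′ = solve-∀

        χ-∈? : ∀ (A : Subset n) x → χ A x ≡ 𝟙 (does (x ∈? A))
        χ-∈? A x with x ∈? A
        ... | yes x∈A = cong 𝟙 ([]=⇒lookup x∈A)
        ... | no  x∉A = ∉⇒χ≡0 x∉A

        column : ∀ x → a * ∑ G (λ A → b * (χ (petal A) x * q A)) ≤ b * (2 * b * b * V !)
        column x = begin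
          a * ∑ G (λ A → b * (χ (petal A) x * q A))               ≡⟨ cong (a *_) (∑-*ˡ G b _) ⟩
          a * (b * ∑ G (λ A → χ (petal A) x * q A))               ≡⟨ cong (λ s → a * (b * s)) (∑-cong G λ A → cong (_* q A) (χ-∈? (petal A) x)) ⟩
          a * (b * ∑ G (λ A → 𝟙 (does (x ∈? petal A)) * q A))     ≡⟨ cong (λ s → a * (b * s)) (∑-filter (λ A → x ∈? petal A) G q) ⟨
          a * (b * ∑ (G∋ x) q)                                    ≡⟨ lemma′ a b _ ⟩
          b * (a * ∑ (G∋ x) q)                                    ≤⟨ *-monoʳ-≤ b (through x) ⟩
          b * (2 * b * b * V !)                                   ∎
          where
          lemma′ : ∀ a b s → a * (b * s) ≡ b * (a * s)
          lemma′ = solve-∀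

      -- Members of small layers and the combined bound

      small : ℕ → ℕ
      small k = 𝟙 (not (does (large? k)))

      -- Grouping by size, with V + 1 candidate sizes: a large layer contributes nothing, any other
      -- at most 3 V².
      small-layers≤ : ∑ As (λ A → small ∣ A ∣) ≤ suc V * (3 * (V * V))
      small-layers≤ = ∑-fibres≤ As (λ A → small ∣ A ∣) ∣_∣ (λ A∈ → s≤s ∣ A∈ ∣≤V) λ k → begin
        ∑ As (λ A → small ∣ A ∣ * 𝟙 (does (∣ A ∣ ≟ k)))      ≡⟨ ∑-cong As (λ A → transport A k) ⟩
        ∑ As (λ A → small k * 𝟙 (does (∣ A ∣ ≟ k)))          ≡⟨ ∑-*ˡ As (small k) _ ⟩
        small k * ∑ As (λ A → 𝟙 (does (∣ A ∣ ≟ k)))          ≡⟨ cong (small k *_) (count k) ⟩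
        small k * length (layer k)                           ≤⟨ small≤ k ⟩
        3 * (V * V)                                          ∎
        where
        open ≤-Reasoning
        transport : ∀ A k → small ∣ A ∣ * 𝟙 (does (∣ A ∣ ≟ k)) ≡ small k * 𝟙 (does (∣ A ∣ ≟ k))
        transport A k = by-cases (∣ A ∣ ≟ k)
          where
          -- Taking the decision as an argument lets a match on it identify k with |A|.
          by-cases : (d : Dec (∣ A ∣ ≡ k)) → small ∣ A ∣ * 𝟙 (does d) ≡ small k * 𝟙 (does d)
          by-cases (yes refl) = refl
          by-cases (no _)     = trans (*-zeroʳ (small ∣ A ∣)) (sym (*-zeroʳ (small k)))

        count : ∀ k → ∑ As (λ A → 𝟙 (does (∣ A ∣ ≟ k))) ≡ length (layer k)
        count k = trans (∑-cong As λ A → sym (*-identityʳ _))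
          (trans (sym (∑-filter (λ A → ∣ A ∣ ≟ k) As (λ _ → 1)))
          (trans (∑-const (layer k) 1) (*-identityʳ _)))

        small≤ : ∀ k → small k * length (layer k) ≤ 3 * (V * V)
        small≤ k = by-cases (large? k)
          where
          by-cases : (d : Dec (Large k)) → 𝟙 (not (does d)) * length (layer k) ≤ 3 * (V * V)
          by-cases (yes _)     = z≤n
          by-cases (no ¬large) = ≤-trans (≤-reflexive (*-identityˡ _)) (≮⇒≥ ¬large)

    length≤2b³n+3[1+V]V² : length As ≤ 2 * b * b * b * n + suc V * (3 * (V * V))
    length≤2b³n+3[1+V]V² = begin
      length As                                                              ≡⟨ *-identityʳ _ ⟨
      length As * 1                                                          ≡⟨ ∑-const As 1 ⟨
      ∑ As (λ _ → 1)                                                         ≡⟨ ∑-cong As (λ A → 𝟙-not (does (large? ∣ A ∣))) ⟨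
      ∑ As (λ A → 𝟙 (does (large? ∣ A ∣)) + small ∣ A ∣)                     ≡⟨ ∑-+ As _ _ ⟩
      ∑ As (λ A → 𝟙 (does (large? ∣ A ∣))) + ∑ As (λ A → small ∣ A ∣)        ≡⟨ cong (_+ ∑ As (λ A → small ∣ A ∣)) count ⟩
      length G + ∑ As (λ A → small ∣ A ∣)                                    ≤⟨ +-mono-≤ length-G≤ small-layers≤ ⟩
      2 * b * b * b * n + suc V * (3 * (V * V))                              ∎
      where
      open ≤-Reasoning
      count : ∑ As (λ A → 𝟙 (does (large? ∣ A ∣))) ≡ length G
      count = trans (∑-cong As λ A → sym (*-identityʳ _))
        (trans (sym (∑-filter (λ A → large? ∣ A ∣) As (λ _ → 1)))
        (trans (∑-const G 1) (*-identityʳ _)))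

-- Rational and real bounds

open import Data.Nat as ℕ using (ℕ)
open import Data.Product using (∃-syntax; _×_)
open import Data.Rational using (ℚ; 0ℚ; 1ℚ; _<_; _≤_; _*_)

open import Algebra.Bundles using (CommutativeMonoid)
import Algebra.Properties.CommutativeSemigroup as CommutativeSemigroupProperties
open import Data.Fin.Subset using (Subset; Nonempty; _∩_; ∣_∣)
open import Data.Fin.Subset.Properties using (x∈p⇒∣p-x∣<∣p∣)
open import Data.Integer as ℤ using (+_)
import Data.Integer.Properties as ℤ
open import Data.List using (List; []; _∷_)
open import Data.List.Membership.Propositional using (_∈_)
open import Data.List.Relation.Unary.Any using (here; there)
open import Data.Nat using (zero; suc; z≤n; s≤s)
import Data.Nat.Properties as ℕ
open import Data.Nat.Tactic.RingSolver using (solve-∀)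
open import Data.Product using (_,_)
open import Data.Rational using (mkℚ; _÷_; 1/_; Positive; NonNegative; toℚᵘ; *<*; nonNegative)
open import Data.Rational.Properties as ℚ using (toℚᵘ-injective; toℚᵘ-fromℚᵘ; toℚᵘ-homo-*; toℚᵘ-cancel-≤; toℚᵘ-mono-≤)
open import Data.Rational.Unnormalised as ℚᵘ using (mkℚᵘ; *≡*; *≤*)
import Data.Rational.Unnormalised.Properties as ℚᵘ
open import Data.Sum as Sum using (inj₁; inj₂)
open import Relation.Binary.PropositionalEquality
import Relation.Binary.Reasoning.Setoid as SetoidReasoning

private
  module ≃-Reasoning = SetoidReasoning ℚᵘ.≃-setoid

open Combinatorics using (length≤2b³n+3[1+V]V²)

-- The argument 0 of `mkℚᵘ` is the denominator minus one. Passing to unnormalised fractions bypasses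
-- the gcd normalisation, so that order and products reduce to integer arithmetic.
fromℕ≃ : ∀ m → toℚᵘ (fromℕ m) ℚᵘ.≃ mkℚᵘ (+ m) 0
fromℕ≃ m = toℚᵘ-fromℚᵘ (mkℚᵘ (+ m) 0)

fromℕ-mono-≤ : ∀ {m n} → m ℕ.≤ n → fromℕ m ≤ fromℕ n
fromℕ-mono-≤ {m} {n} m≤n = toℚᵘ-cancel-≤
  (ℚᵘ.≤-respʳ-≃ (ℚᵘ.≃-sym (fromℕ≃ n)) (ℚᵘ.≤-respˡ-≃ (ℚᵘ.≃-sym (fromℕ≃ m))
    (*≤* (ℤ.*-monoʳ-≤-nonNeg (+ 1) (ℤ.+≤+ m≤n)))))

fromℕ-cancel-≤ : ∀ {m n} → fromℕ m ≤ fromℕ n → m ℕ.≤ n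
fromℕ-cancel-≤ {m} {n} m≤n with ℚᵘ.≤-respʳ-≃ (fromℕ≃ n) (ℚᵘ.≤-respˡ-≃ (fromℕ≃ m) (toℚᵘ-mono-≤ m≤n))
... | *≤* m*1≤n*1 = ℤ.drop‿+≤+ (subst₂ ℤ._≤_ (ℤ.*-identityʳ (+ m)) (ℤ.*-identityʳ (+ n)) m*1≤n*1)

fromℕ-injective : ∀ {m n} → fromℕ m ≡ fromℕ n → m ≡ n
fromℕ-injective eq = ℕ.≤-antisym (fromℕ-cancel-≤ (ℚ.≤-reflexive eq)) (fromℕ-cancel-≤ (ℚ.≤-reflexive (sym eq)))

fromℕ-mono-< : ∀ {m n} → m ℕ.< n → fromℕ m < fromℕ n
fromℕ-mono-< {m} {n} m<n = ℚ.≰⇒> λ n≤m → ℕ.<⇒≱ m<n (fromℕ-cancel-≤ n≤m)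

fromℕ-* : ∀ m n → fromℕ (m ℕ.* n) ≡ fromℕ m * fromℕ n
fromℕ-* m n = toℚᵘ-injective (begin
  toℚᵘ (fromℕ (m ℕ.* n))               ≈⟨ fromℕ≃ (m ℕ.* n) ⟩
  mkℚᵘ (+ (m ℕ.* n)) 0                 ≈⟨ *≡* (cong (ℤ._* + 1) (ℤ.pos-* m n)) ⟩
  mkℚᵘ (+ m) 0 ℚᵘ.* mkℚᵘ (+ n) 0       ≈⟨ ℚᵘ.*-cong (fromℕ≃ m) (fromℕ≃ n) ⟨
  toℚᵘ (fromℕ m) ℚᵘ.* toℚᵘ (fromℕ n)   ≈⟨ toℚᵘ-homo-* (fromℕ m) (fromℕ n) ⟨
  toℚᵘ (fromℕ m * fromℕ n)             ∎)
  where open ≃-Reasoning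

fraction : ∀ θ → 0ℚ < θ → θ < 1ℚ → ∃[ a ] ∃[ b ] 0 ℕ.< a × a ℕ.< b × fromℕ b * θ ≡ fromℕ a
fraction (mkℚ (+ a) b-1 c) (*<* 0<θ) (*<* θ<1) = a , suc b-1 ,
  ℤ.drop‿+<+ (subst₂ ℤ._<_ (ℤ.*-zeroˡ (+ suc b-1)) (ℤ.*-identityʳ (+ a)) 0<θ) ,
  ℤ.drop‿+<+ (subst₂ ℤ._<_ (ℤ.*-identityʳ (+ a)) (ℤ.*-identityˡ (+ suc b-1)) θ<1) ,
  toℚᵘ-injective (begin
    toℚᵘ (fromℕ (suc b-1) * θ)                       ≈⟨ toℚᵘ-homo-* (fromℕ (suc b-1)) θ ⟩
    toℚᵘ (fromℕ (suc b-1)) ℚᵘ.* mkℚᵘ (+ a) b-1       ≈⟨ ℚᵘ.*-congʳ {mkℚᵘ (+ a) b-1} (fromℕ≃ (suc b-1)) ⟩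
    mkℚᵘ (+ suc b-1) 0 ℚᵘ.* mkℚᵘ (+ a) b-1           ≈⟨ *≡* (lemma (+ suc b-1) (+ a)) ⟩
    mkℚᵘ (+ a) 0                                     ≈⟨ fromℕ≃ a ⟨
    toℚᵘ (fromℕ a)                                   ∎)
  where
  open ≃-Reasoning
  θ = mkℚ (+ a) b-1 c
  lemma : ∀ b a → b ℤ.* a ℤ.* + 1 ≡ a ℤ.* (+ 1 ℤ.* b)
  lemma b a = trans (ℤ.*-identityʳ _) (trans (ℤ.*-comm b a) (cong (a ℤ.*_) (sym (ℤ.*-identityˡ b))))

clear-denominator : ∀ θ a b s t → fromℕ b * θ ≡ fromℕ a → fromℕ s ≡ θ * fromℕ t → b ℕ.* s ≡ a ℕ.* t
clear-denominator θ a b s t bθ≡a s≡θt = fromℕ-injective (begin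
  fromℕ (b ℕ.* s)          ≡⟨ fromℕ-* b s ⟩
  fromℕ b * fromℕ s        ≡⟨ cong (fromℕ b *_) s≡θt ⟩
  fromℕ b * (θ * fromℕ t)  ≡⟨ ℚ.*-assoc (fromℕ b) θ (fromℕ t) ⟨
  fromℕ b * θ * fromℕ t    ≡⟨ cong (_* fromℕ t) bθ≡a ⟩
  fromℕ a * fromℕ t        ≡⟨ fromℕ-* a t ⟨
  fromℕ (a ℕ.* t)          ∎)
  where open ≡-Reasoning

-- The absolute value of the numerator suffices, as the denominator is at least 1.
archimedean : ∀ K → ∃[ M ] K ≤ fromℕ M
archimedean K@(mkℚ p d-1 _) = ℤ.∣ p ∣ , toℚᵘ-cancel-≤ (ℚᵘ.≤-respʳ-≃ (ℚᵘ.≃-sym (fromℕ≃ ℤ.∣ p ∣))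
  (*≤* (ℤ.≤-trans (ℤ.*-monoʳ-≤-nonNeg (+ 1) (i≤∣i∣ p)) (ℤ.*-monoˡ-≤-nonNeg (+ ℤ.∣ p ∣) (ℤ.+≤+ (s≤s z≤n))))))
  where
  i≤∣i∣ : ∀ i → i ℤ.≤ + ℤ.∣ i ∣
  i≤∣i∣ (+ n)       = ℤ.≤-refl
  i≤∣i∣ ℤ.-[1+ n ]  = ℤ.-≤+

fromℕ≥0 : ∀ m → NonNegative (fromℕ m)
fromℕ≥0 m = ℚ.normalize-nonNeg m 1

-- Cubes and the growth condition

³-mono-≤ : ∀ {q r} → 0ℚ ≤ q → q ≤ r → q ³ ≤ r ³
³-mono-≤ {q} {r} 0≤q q≤r = begin
  q * q * q ≤⟨ ℚ.*-monoʳ-≤-nonNeg q (ℚ.*-monoʳ-≤-nonNeg q q≤r) ⟩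
  r * q * q ≤⟨ ℚ.*-monoʳ-≤-nonNeg q (ℚ.*-monoˡ-≤-nonNeg r q≤r) ⟩
  r * r * q ≤⟨ ℚ.*-monoˡ-≤-nonNeg (r * r) q≤r ⟩
  r * r * r ∎
  where
  open ℚ.≤-Reasoning
  instance
    _ : NonNegative q
    _ = nonNegative 0≤q
    r≥0 : NonNegative r
    r≥0 = nonNegative (ℚ.≤-trans 0≤q q≤r)
    _ : NonNegative (r * r)
    _ = ℚ.nonNeg*nonNeg⇒nonNeg r r

³-* : ∀ q r → (q * r) ³ ≡ q ³ * r ³
³-* q r = begin
  q * r * (q * r) * (q * r)      ≡⟨ cong (_* (q * r)) (interchange q r q r) ⟩
  q * q * (r * r) * (q * r)      ≡⟨ interchange (q * q) (r * r) q r ⟩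
  q * q * q * (r * r * r)        ∎
  where
  open ≡-Reasoning
  open CommutativeSemigroupProperties (CommutativeMonoid.commutativeSemigroup ℚ.*-1-commutativeMonoid) using (interchange)

fromℕ-³ : ∀ m → fromℕ (m ℕ.* m ℕ.* m) ≡ fromℕ m ³
fromℕ-³ m = trans (fromℕ-* (m ℕ.* m) m) (cong (_* fromℕ m) (fromℕ-* m m))

-- The lower cut of fromℚ s misses s, so the bound is read off at s - 1; this costs the factor 8.
cube≤ : ∀ {K M n s} {{K>0 : Positive K}} → K ≤ fromℕ M → 0 ℕ.< n →
  fromℚ (fromℕ s) ≤ᵣ K • ∛ n → s ℕ.* s ℕ.* s ℕ.≤ 8 ℕ.* (M ℕ.* M ℕ.* M ℕ.+ 1) ℕ.* n
cube≤ {s = zero} _ _ _ = z≤n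
cube≤ {K} {M} {n} {suc s} {{K>0}} K≤M 0<n s≤w with s≤w (fromℕ s) (fromℕ-mono-< {s} {suc s} ℕ.≤-refl)
-- The lower cut of `∛ n` at s / K supplies r, so s ≤ r K ≤ r M and s³ ≤ n M³.
... | r , s/K<r , r³<n = begin
  suc s ℕ.* suc s ℕ.* suc s                  ≤⟨ suc³≤ s ⟩
  8 ℕ.* (s ℕ.* s ℕ.* s ℕ.+ 1)                ≤⟨ ℕ.*-monoʳ-≤ 8 (ℕ.+-mono-≤ s³≤nM³ 0<n) ⟩
  8 ℕ.* (n ℕ.* (M ℕ.* M ℕ.* M) ℕ.+ n)        ≡⟨ lemma n (M ℕ.* M ℕ.* M) ⟩
  8 ℕ.* (M ℕ.* M ℕ.* M ℕ.+ 1) ℕ.* n          ∎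
  where
  open ℕ.≤-Reasoning
  lemma : ∀ n m → 8 ℕ.* (n ℕ.* m ℕ.+ n) ≡ 8 ℕ.* (m ℕ.+ 1) ℕ.* n
  lemma = solve-∀

  -- The factor 8 is 2³, from s + 1 ≤ 2 s for s ≥ 1; the summand 1 covers s = 0.
  suc³≤ : ∀ s → suc s ℕ.* suc s ℕ.* suc s ℕ.≤ 8 ℕ.* (s ℕ.* s ℕ.* s ℕ.+ 1)
  suc³≤ zero    = s≤s z≤n
  suc³≤ (suc s) = begin
    (2 ℕ.+ s) ℕ.* (2 ℕ.+ s) ℕ.* (2 ℕ.+ s)
      ≤⟨ ℕ.*-mono-≤ (ℕ.*-mono-≤ 2+s≤ 2+s≤) 2+s≤ ⟩
    2 ℕ.* suc s ℕ.* (2 ℕ.* suc s) ℕ.* (2 ℕ.* suc s)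
      ≡⟨ lemma′ (suc s) ⟩
    8 ℕ.* (suc s ℕ.* suc s ℕ.* suc s)
      ≤⟨ ℕ.*-monoʳ-≤ 8 (ℕ.m≤m+n (suc s ℕ.* suc s ℕ.* suc s) 1) ⟩
    8 ℕ.* (suc s ℕ.* suc s ℕ.* suc s ℕ.+ 1) ∎
    where
    lemma′ : ∀ m → 2 ℕ.* m ℕ.* (2 ℕ.* m) ℕ.* (2 ℕ.* m) ≡ 8 ℕ.* (m ℕ.* m ℕ.* m)
    lemma′ = solve-∀
    double : ∀ s → 2 ℕ.* suc s ≡ 2 ℕ.+ s ℕ.+ s
    double = solve-∀
    2+s≤ : 2 ℕ.+ s ℕ.≤ 2 ℕ.* suc s
    2+s≤ = ℕ.≤-trans (ℕ.m≤m+n (2 ℕ.+ s) s) (ℕ.≤-reflexive (sym (double s)))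

  instance
    _ = ℚ.pos⇒nonZero K
    _ = ℚ.pos⇒nonNeg K
    _ = ℚ.1/pos⇒pos K
    _ = fromℕ≥0 s
    _ = fromℕ≥0 M
    _ = ℚ.pos⇒nonNeg (1/ K)

  s³≤nM³ : s ℕ.* s ℕ.* s ℕ.≤ n ℕ.* (M ℕ.* M ℕ.* M)
  s³≤nM³ = fromℕ-cancel-≤ (ℚ.≤-trans (ℚ.≤-reflexive (fromℕ-³ s))
    (ℚ.≤-trans (³-mono-≤ (ℚ.nonNegative⁻¹ (fromℕ s)) s≤rM)
    (ℚ.≤-trans (ℚ.≤-reflexive (³-* r (fromℕ M)))
    (ℚ.≤-trans (ℚ.*-monoʳ-≤-nonNeg (fromℕ M ³) (ℚ.<⇒≤ r³<n))
    (ℚ.≤-reflexive (trans (cong (fromℕ n *_) (sym (fromℕ-³ M))) (sym (fromℕ-* n (M ℕ.* M ℕ.* M)))))))))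
    where
    instance
      r≥0 : NonNegative r
      r≥0 = nonNegative (ℚ.≤-trans (ℚ.nonNegative⁻¹ (fromℕ s ÷ K) {{ℚ.nonNeg*nonNeg⇒nonNeg (fromℕ s) (1/ K)}}) (ℚ.<⇒≤ s/K<r))
      _ : NonNegative (fromℕ M ³)
      _ = subst NonNegative (fromℕ-³ M) (fromℕ≥0 (M ℕ.* M ℕ.* M))

    ÷-*-cancel : fromℕ s ÷ K * K ≡ fromℕ s
    ÷-*-cancel = trans (ℚ.*-assoc (fromℕ s) (1/ K) K)
      (trans (cong (fromℕ s *_) (ℚ.*-inverseˡ K)) (ℚ.*-identityʳ (fromℕ s)))

    s≤rM : fromℕ s ≤ r * fromℕ M
    s≤rM = ℚ.≤-trans (subst (_≤ r * K) ÷-*-cancel (ℚ.*-monoʳ-≤-nonNeg K (ℚ.<⇒≤ s/K<r)))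
      (ℚ.*-monoˡ-≤-nonNeg r K≤M)

-- On a nonempty list V is the maximum, itself one of the values, so it inherits the cube bound.
-- This replaces an integer cube root of c.
cube-bounded-max : ∀ {X : Set} (f : X → ℕ) c (xs : List X) → (∀ {x} → x ∈ xs → f x ℕ.* f x ℕ.* f x ℕ.≤ c) →
  ∃[ V ] V ℕ.* V ℕ.* V ℕ.≤ c × (∀ {x} → x ∈ xs → f x ℕ.≤ V)
cube-bounded-max f c []       f³≤c = 0 , z≤n , λ ()
cube-bounded-max f c (x ∷ xs) f³≤c with cube-bounded-max f c xs (λ x∈ → f³≤c (there x∈))
... | V , V³≤c , f≤V = f x ℕ.⊔ V , cube , λ where
      (here refl) → ℕ.m≤m⊔n (f x) V
      (there x∈)  → ℕ.≤-trans (f≤V x∈) (ℕ.m≤n⊔m (f x) V)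
  where
  cube : (f x ℕ.⊔ V) ℕ.* (f x ℕ.⊔ V) ℕ.* (f x ℕ.⊔ V) ℕ.≤ c
  cube with ℕ.⊔-sel (f x) V
  ... | inj₁ eq rewrite eq = f³≤c (here refl)
  ... | inj₂ eq rewrite eq = V³≤c

-- For V ≥ 1 this is 1 + V ≤ 2 V; at V = 0 both sides vanish.
3[1+V]V²≤6V³ : ∀ V → suc V ℕ.* (3 ℕ.* (V ℕ.* V)) ℕ.≤ 6 ℕ.* (V ℕ.* V ℕ.* V)
3[1+V]V²≤6V³ zero      = z≤n
3[1+V]V²≤6V³ V@(suc _) = begin
  suc V ℕ.* (3 ℕ.* (V ℕ.* V))          ≤⟨ ℕ.*-monoˡ-≤ (3 ℕ.* (V ℕ.* V)) (ℕ.+-monoˡ-≤ V {1} {V} (s≤s z≤n)) ⟩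
  (V ℕ.+ V) ℕ.* (3 ℕ.* (V ℕ.* V))      ≡⟨ lemma V ⟩
  6 ℕ.* (V ℕ.* V ℕ.* V)                ∎
  where
  open ℕ.≤-Reasoning
  lemma : ∀ V → (V ℕ.+ V) ℕ.* (3 ℕ.* (V ℕ.* V)) ≡ 6 ℕ.* (V ℕ.* V ℕ.* V)
  lemma = solve-∀

Nonempty⇒0<∣∣ : ∀ {n} {A : Subset n} → Nonempty A → 0 ℕ.< ∣ A ∣
Nonempty⇒0<∣∣ (x , x∈A) = ℕ.≤-<-trans z≤n (x∈p⇒∣p-x∣<∣p∣ x∈A)

theorem1p5 : ∀ (θ : ℚ) → 0ℚ < θ → θ < 1ℚ →
    ∀ (w : Seq) → (∀ n → .{{_ : ℕ.NonZero n}} → Positiveᵣ (w n)) →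
    w =O[ (λ n → ∛ n) ] →
    ∃[ C ] 0ℚ < C × (∃[ N ] (∀ n → .{{_ : ℕ.NonZero n}} → N ℕ.≤ n →
    ∀ (F : Family n) → Bounded (w n) F → Intersecting θ F →
    fromℕ (size F) ≤ C * fromℕ n))
theorem1p5 θ 0<θ θ<1 w _ (K , K>0 , N , w≤K∛) with fraction θ 0<θ θ<1 | archimedean K
... | a , b , 0<a , a<b , bθ≡a | M , K≤M = fromℕ C , fromℕ-mono-< {0} {C} (s≤s z≤n) , N , linear
  where
  -- By `cube≤`, c n bounds the cube of every size, hence V³. In C, the term 2 b³ accounts for the
  -- large layers and 6 c for the small ones; the successor makes C positive.
  c C : ℕ
  c = 8 ℕ.* (M ℕ.* M ℕ.* M ℕ.+ 1)
  C = suc (2 ℕ.* b ℕ.* b ℕ.* b ℕ.+ 6 ℕ.* c)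

  linear : ∀ n → .{{_ : ℕ.NonZero n}} → N ℕ.≤ n → ∀ (F : Family n) → Bounded (w n) F → Intersecting θ F →
    fromℕ (size F) ≤ fromℕ C * fromℕ n
  linear n N≤n F bounded int with cube-bounded-max ∣_∣ (c ℕ.* n) (members F) (λ {A} A∈ → cube≤ {K} {M} {n} {∣ A ∣} {{K>0}}
      K≤M (ℕ.n≢0⇒n>0 (ℕ.≢-nonZero⁻¹ n)) (λ q q<∣A∣ → w≤K∛ n N≤n q (bounded A∈ q q<∣A∣)))
  ... | V , V³≤cn , ∣A∣≤V = subst (fromℕ (size F) ≤_) (fromℕ-* C n) (fromℕ-mono-≤ (begin
    size F                                                       ≤⟨ length≤2b³n+3[1+V]V² 0<a a<b (distinct F)
                                                                      (λ A∈ → Nonempty⇒0<∣∣ (nonempty A∈)) ∣A∣≤V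
                                                                      (λ {A} {B} A∈ B∈ A≢B → Sum.map
                                                                        (clear-denominator θ a b ∣ A ∩ B ∣ ∣ A ∣ bθ≡a)
                                                                        (clear-denominator θ a b ∣ A ∩ B ∣ ∣ B ∣ bθ≡a)
                                                                        (intersecting A∈ B∈ A≢B)) ⟩
    2 ℕ.* b ℕ.* b ℕ.* b ℕ.* n ℕ.+ suc V ℕ.* (3 ℕ.* (V ℕ.* V))    ≤⟨ ℕ.+-monoʳ-≤ (2 ℕ.* b ℕ.* b ℕ.* b ℕ.* n)
                                                                      (ℕ.≤-trans (3[1+V]V²≤6V³ V) (ℕ.*-monoʳ-≤ 6 V³≤cn)) ⟩
    2 ℕ.* b ℕ.* b ℕ.* b ℕ.* n ℕ.+ 6 ℕ.* (c ℕ.* n)                ≤⟨ ℕ.m≤n+m _ n ⟩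
    n ℕ.+ (2 ℕ.* b ℕ.* b ℕ.* b ℕ.* n ℕ.+ 6 ℕ.* (c ℕ.* n))        ≡⟨ lemma b c n ⟩
    C ℕ.* n                                                      ∎))
    where
    open ℕ.≤-Reasoning
    open Intersecting int
    lemma : ∀ b c n → n ℕ.+ (2 ℕ.* b ℕ.* b ℕ.* b ℕ.* n ℕ.+ 6 ℕ.* (c ℕ.* n)) ≡ suc (2 ℕ.* b ℕ.* b ℕ.* b ℕ.+ 6 ℕ.* c) ℕ.* n
    lemma = solve-∀
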